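{- Let $d$ be a squarefree integer such that the quadratic field $\mathbb{Q}(\sqrt{d})$ is norm-Euclidean, and let $\mathbb{D}[d]$ denote its ring of integers. Then there exists a finite set $\mathcal{E}_d \subset \mathbb{D}[d]$ such that for every $n \in \mathbb{D}[d] \setminus \mathcal{E}_d$ there exist nonzero $a, b, c \in \mathbb{D}[d]$ with $$\frac{4}{n} = \frac{1}{a} + \frac{1}{b} + \frac{1}{c}.$$
   Context: $\mathbb{D}[d]$ is the ring of integers of $\mathbb{Q}(\sqrt{d})$: it equals $\mathbb{Z}[\sqrt{d}]$ if $d \equiv 2,3 \pmod 4$ and $\mathbb{Z}[\tfrac{1+\sqrt{d}}{2}]$ if $d \equiv 1 \pmod 4$. The field $\mathbb{Q}(\sqrt{d})$ is norm-Euclidean if $\mathbb{D}[d]$ is a Euclidean domain with respect to the absolute value of the field norm. (Known classification: this holds exactly for $d \in \{ -11,-7,-3,-2,-1,2,3,5,6,7,11,13,17,19,21,29,33,37,41,57,73\}$.) The equation is read in the field $\mathbb{Q}(\sqrt{d})$. -}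

module Defs where

open import Data.Nat as ℕ using (ℕ)
open import Data.Integer using (ℤ; +_; _+_; _-_; _*_; -_; ∣_∣)
open import Data.Integer.DivMod using (_%ℕ_; _/ℕ_)
open import Data.Nat.Divisibility as ℕD using ()
open import Data.Product using (_×_; _,_; ∃-syntax)
open import Relation.Binary.PropositionalEquality using (_≡_; _≢_)

Squarefree : ℤ → Set
Squarefree d = (m : ℕ) → (m ℕ.* m) ℕD.∣ ∣ d ∣ → m ≡ 1

-- Elements of 𝔻[d] written in the Z-basis {1, ω}, the pair (a , b) standing
-- for a + b ω, where ω = √d if d ≢ 1 (mod 4) and ω = (1 + √d)/2 if d ≡ 1 (mod 4).
𝔻 : Set
𝔻 = ℤ × ℤ

-- ω² = ωc₀ d + ωc₁ d · ω
-- d ≡ 1 (mod 4):  ω² = (d - 1)/4 + ω ;  otherwise ω² = d.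
ωc₀ : ℤ → ℤ
ωc₀ d with d %ℕ 4
... | 1 = (d - + 1) /ℕ 4
... | _ = d

ωc₁ : ℤ → ℤ
ωc₁ d with d %ℕ 4
... | 1 = + 1
... | _ = + 0

module Ring (d : ℤ) where
  infixl 6 _⊕_
  infixl 7 _⊗_

  _⊕_ : 𝔻 → 𝔻 → 𝔻
  (a , b) ⊕ (c , e) = (a + c , b + e)

  _⊗_ : 𝔻 → 𝔻 → 𝔻
  (a , b) ⊗ (c , e) = (a * c + b * e * ωc₀ d , a * e + b * c + b * e * ωc₁ d)

  𝟘 : 𝔻
  𝟘 = (+ 0 , + 0)

  𝟜 : 𝔻
  𝟜 = (+ 4 , + 0)

  -- Field norm N(a + b ω) = (a + b ω)(a + b ω̄)
  norm : 𝔻 → ℤ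
  norm (a , b) = a * a + ωc₁ d * a * b - ωc₀ d * b * b

NormEuclidean : ℤ → Set
NormEuclidean d = (x y : 𝔻) → y ≢ 𝟘 →
    ∃[ q ] ∃[ r ] ((x ≡ q ⊗ y ⊕ r) × (∣ norm r ∣ ℕ.< ∣ norm y ∣))
  where open Ring d

-- 4/n = 1/a + 1/b + 1/c in Q(√d), for nonzero a b c n, cleared of denominators:
-- 4abc = n(bc + ac + ab).  (Given a,b,c ≠ 0 this also forces n ≠ 0.)
ErdosStraus : ℤ → 𝔻 → Set
ErdosStraus d n = ∃[ a ] ∃[ b ] ∃[ c ]
    (a ≢ 𝟘 × b ≢ 𝟘 × c ≢ 𝟘 × (𝟜 ⊗ a ⊗ b ⊗ c ≡ n ⊗ (b ⊗ c ⊕ a ⊗ c ⊕ a ⊗ b)))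
  where open Ring d

{-# OPTIONS --safe #-}
-- If n + f = 4k, p + q = gf and pp′ = qq′ = nk, then
--   4/n = 1/k + f/(nk) = 1/k + (p + q)/(gnk) = 1/k + 1/(gp′) + 1/(gq′).
--
-- For d > 0 take k ∈ {1, 2} and R = N(f). Pell's equation for dR² gives a unit
-- ε = x + yR√d of norm 1, and ε - ε̄ = 2yR√d is a multiple of f, so that p = ε and
-- q = -ε̄ will do. Only n = 0 is excluded.
--
-- For d < 0, dividing ω by 2 with remainder leaves d = -1, -2, -3, -7, -11. There f is
-- chosen in terms of n modulo 4, p is a constant or one of k, n, nk, and q is a constant
-- dividing k; whether f divides p + q depends only on n modulo some 4P, and finitely many
-- choices of (f, p, q), together with the multiples of a few n for which 4/n has been
-- decomposed, cover all residue classes up to sign. Only some small n are excluded.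
module Submission where

open import Defs
open import Algebra.Bundles using (CommutativeRing; CommutativeSemiring)
open import Algebra.Structures using (IsCommutativeRing)
open import Data.Bool using (Bool; T; _∨_)
open import Data.Bool.ListAction using (any; all)
open import Data.Bool.Properties using (T-∨)
open import Data.Empty using (⊥-elim)
open import Data.Fin using (Fin; toℕ; fromℕ<; combine) renaming (zero to fzero; suc to fsuc)
open import Data.Fin.Properties using (pigeonhole; combine-injective; fromℕ<-injective)
open import Data.List using (List; []; _∷_; map; upTo; _++_; cartesianProduct)
open import Data.List.Membership.Propositional using (_∈_; _∉_; find)
open import Data.List.Membership.Propositional.Properties
  using (∈-map⁺; ∈-upTo⁺; ∈-++⁺ˡ; ∈-++⁺ʳ; ∈-cartesianProduct⁺)
open import Data.List.Relation.Unary.All as All using ()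
open import Data.List.Relation.Unary.All.Properties using (all⁺)
open import Data.List.Relation.Unary.Any using (here)
open import Data.List.Relation.Unary.Any.Properties using (any⁻)
open import Data.Nat as ℕ using (ℕ; zero; suc; z≤n; s≤s)
open import Data.Nat.Coprimality as Coprime using (coprime-divisor)
open import Data.Nat.Divisibility as ℕD using (divides)
open import Data.Nat.DivMod as ℕDM using ()
open import Data.Nat.GCD as GCD using (gcd)
open import Data.Nat.Properties as ℕₚ using ()
open import Data.Nat.Tactic.RingSolver using () renaming (solve-∀ to ℕ-solve-∀)
open import Data.Product using (_×_; _,_; Σ; ∃; ∃₂; proj₁; proj₂)
open import Data.Sign using (Sign)
open import Data.Sum using (_⊎_; inj₁; inj₂; [_,_]′)
open import Data.Unit using (⊤; tt)
open import Function using (case_of_; _∘_; id)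
open import Function.Bundles using (Equivalence)
open import Level using (0ℓ)
open import Relation.Binary.Definitions using (tri<; tri≈; tri>)
open import Relation.Binary.PropositionalEquality
  using (_≡_; _≢_; refl; sym; trans; cong; cong₂; subst; isEquivalence; module ≡-Reasoning)
open import Relation.Nullary using (¬_)
open import Relation.Nullary.Decidable
  using (Dec; yes; does; map′; toSum; decidable-stable; _×-dec_; ¬?)

-- The difficulty lies in finding p and q: both must divide nk while f divides their sum. Units
-- divide everything, and a real field has infinitely many of them, so for any f ≠ 0 some pair of
-- units is suitable. An imaginary field has at most six units. There f is kept to a few elements of
-- small norm, and the residue of n modulo f decides which p and q work; this is a finite
-- computation. Pell's equation is solved by Conway's river because it needs no approximation of √D
-- by rationals: the forms met along the river have integer coefficients bounded in terms of D, so
-- one of them recurs.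

module SemiringIdentities {c ℓ} (R : CommutativeSemiring c ℓ) where
  open CommutativeSemiring R hiding (sym; trans; isEquivalence) renaming (refl to ≈-refl)
  open import Algebra.Solver.Ring.NaturalCoefficients.Default R
  open import Relation.Binary.Reasoning.Setoid setoid

  split-identity : ∀ {four n k f g p q p′ q′} → four * k ≈ n + f → p + q ≈ g * f →
    p′ * p ≈ n * k → q′ * q ≈ n * k →
    four * k * (g * p′) * (g * q′) ≈
    n * (g * p′ * (g * q′) + k * (g * q′) + k * (g * p′))
  split-identity {four} {n} {k} {f} {g} {p} {q} {p′} {q′} 4k≈n+f p+q≈gf p′p≈nk q′q≈nk = begin
    four * k * (g * p′) * (g * q′)
      ≈⟨ *-congʳ (*-congʳ 4k≈n+f) ⟩
    (n + f) * (g * p′) * (g * q′)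
      ≈⟨ solve 5 (λ n f g p′ q′ → (n :+ f) :* (g :* p′) :* (g :* q′)
           := n :* (g :* p′ :* (g :* q′)) :+ g :* p′ :* q′ :* (g :* f)) ≈-refl n f g p′ q′ ⟩
    n * (g * p′ * (g * q′)) + g * p′ * q′ * (g * f)
      ≈⟨ +-congˡ (*-congˡ p+q≈gf) ⟨
    n * (g * p′ * (g * q′)) + g * p′ * q′ * (p + q)
      ≈⟨ solve 6 (λ n g p q p′ q′ → n :* (g :* p′ :* (g :* q′)) :+ g :* p′ :* q′ :* (p :+ q)
           := n :* (g :* p′ :* (g :* q′)) :+ (g :* q′ :* (p′ :* p) :+ g :* p′ :* (q′ :* q))) ≈-refl n g p q p′ q′ ⟩
    n * (g * p′ * (g * q′)) + (g * q′ * (p′ * p) + g * p′ * (q′ * q))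
      ≈⟨ +-congˡ (+-cong (*-congˡ p′p≈nk) (*-congˡ q′q≈nk)) ⟩
    n * (g * p′ * (g * q′)) + (g * q′ * (n * k) + g * p′ * (n * k))
      ≈⟨ solve 5 (λ n k g p′ q′ → n :* (g :* p′ :* (g :* q′)) :+ (g :* q′ :* (n :* k) :+ g :* p′ :* (n :* k))
           := n :* (g :* p′ :* (g :* q′) :+ k :* (g :* q′) :+ k :* (g :* p′))) ≈-refl n k g p′ q′ ⟩
    n * (g * p′ * (g * q′) + k * (g * q′) + k * (g * p′)) ∎

  -- A common divisor of the modulus and of one representative divides the whole residue class. This
  -- carries a divisibility tested at n₀ over to every n in its class.
  affine-multiple : ∀ {M m x₀ y₀ z} t → m * z ≈ M → y₀ * z ≈ x₀ →
    (m * t + y₀) * z ≈ M * t + x₀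
  affine-multiple {M} {m} {x₀} {y₀} {z} t mz≈M y₀z≈x₀ = begin
    (m * t + y₀) * z      ≈⟨ solve 4 (λ m t y₀ z → (m :* t :+ y₀) :* z := m :* z :* t :+ y₀ :* z) ≈-refl m t y₀ z ⟩
    m * z * t + y₀ * z    ≈⟨ +-cong (*-congʳ mz≈M) y₀z≈x₀ ⟩
    M * t + x₀            ∎

  -- Explains the period 4P of the certificates: k = (n + f)/4 is known modulo P only when n is
  -- known modulo 4P.
  lift-4 : ∀ {four n₀ k₀ f} M t → k₀ * four ≈ n₀ + f →
    four * (M * t + k₀) ≈ (four * M * t + n₀) + f
  lift-4 {four} {n₀} {k₀} {f} M t 4k₀≈ = begin
    four * (M * t + k₀)
      ≈⟨ solve 4 (λ v M t k₀ → v :* (M :* t :+ k₀) := v :* M :* t :+ k₀ :* v) ≈-refl four M t k₀ ⟩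
    four * M * t + k₀ * four ≈⟨ +-congˡ 4k₀≈ ⟩
    four * M * t + (n₀ + f)  ≈⟨ +-assoc _ _ _ ⟨
    (four * M * t + n₀) + f  ∎

  -- Within a class of n modulo 4M, both n and k move by multiples of M, and therefore so does nk.
  product-shift : ∀ four M t n₀ k₀ → (four * M * t + n₀) * (M * t + k₀) ≈
    M * (four * t * (M * t + k₀) + n₀ * t) + n₀ * k₀
  product-shift = solve 5 (λ v M t n₀ k₀ → (v :* M :* t :+ n₀) :* (M :* t :+ k₀) :=
    M :* (v :* t :* (M :* t :+ k₀) :+ n₀ :* t) :+ n₀ :* k₀) ≈-refl

  scaled-identity : ∀ {four a b e z} m → four * a * b * e ≈ z * (b * e + a * e + a * b) →
    four * (m * a) * (m * b) * (m * e) ≈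
    (m * z) * ((m * b) * (m * e) + (m * a) * (m * e) + (m * a) * (m * b))
  scaled-identity {four} {a} {b} {e} {z} m eq = begin
    four * (m * a) * (m * b) * (m * e)
      ≈⟨ solve 5 (λ v m a b e → v :* (m :* a) :* (m :* b) :* (m :* e) :=
           (m :* m :* m) :* (v :* a :* b :* e)) ≈-refl four m a b e ⟩
    (m * m * m) * (four * a * b * e)  ≈⟨ *-congˡ eq ⟩
    (m * m * m) * (z * (b * e + a * e + a * b))
      ≈⟨ solve 5 (λ m z a b e → (m :* m :* m) :* (z :* (b :* e :+ a :* e :+ a :* b)) :=
           (m :* z) :* ((m :* b) :* (m :* e) :+ (m :* a) :* (m :* e) :+ (m :* a) :* (m :* b))) ≈-refl m z a b e ⟩
    (m * z) * ((m * b) * (m * e) + (m * a) * (m * e) + (m * a) * (m * b)) ∎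

module NegationIdentity {c ℓ} (R : CommutativeRing c ℓ) where
  open CommutativeRing R hiding (sym; trans; isEquivalence)
  open import Algebra.Properties.Ring ring
  open import Relation.Binary.Reasoning.Setoid setoid

  -x*-y≈x*y : ∀ x y → - x * - y ≈ x * y
  -x*-y≈x*y x y = begin
    - x * - y      ≈⟨ -‿distribˡ-* x (- y) ⟨
    - (x * - y)    ≈⟨ -‿cong (-‿distribʳ-* x y) ⟨
    - (- (x * y))  ≈⟨ -‿involutive (x * y) ⟩
    x * y          ∎

  -- Both sides have degree three in `m`, `a`, `b`, `e` together, so they change sign together.
  -- Hence residue classes matter only up to sign.
  negated-identity : ∀ {four m a b e} → four * a * b * e ≈ m * (b * e + a * e + a * b) →
    four * - a * - b * - e ≈ - m * (- b * - e + - a * - e + - a * - b)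
  negated-identity {four} {m} {a} {b} {e} eq = begin
    four * - a * - b * - e        ≈⟨ *-congʳ (*-congʳ (-‿distribʳ-* four a)) ⟨
    - (four * a) * - b * - e      ≈⟨ *-congʳ (-x*-y≈x*y (four * a) b) ⟩
    four * a * b * - e            ≈⟨ -‿distribʳ-* (four * a * b) e ⟨
    - (four * a * b * e)          ≈⟨ -‿cong eq ⟩
    - (m * (b * e + a * e + a * b)) ≈⟨ -‿distribˡ-* m _ ⟩
    - m * (b * e + a * e + a * b)
      ≈⟨ *-congˡ (+-cong (+-cong (-x*-y≈x*y b e) (-x*-y≈x*y a e)) (-x*-y≈x*y a b)) ⟨
    - m * (- b * - e + - a * - e + - a * - b) ∎

open import Data.Integer using (ℤ; +_; -[1+_]; +[1+_]; _+_; _-_; _*_; -_; ∣_∣; sign; _◃_)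
open import Data.Integer.DivMod using (_%ℕ_; _/ℕ_; a≡a%ℕn+[a/ℕn]*n; n%ℕd<d)
open import Data.Integer.Properties as ℤₚ using ()
import Algebra.Properties.AbelianGroup ℤₚ.+-0-abelianGroup as ℤ-Group
open import Data.Integer.Tactic.RingSolver using (solve-∀)

-- Pell's equation

∣i∣²≡i² : ∀ i → + (∣ i ∣ ℕ.* ∣ i ∣) ≡ i * i
∣i∣²≡i² (+ zero)  = refl
∣i∣²≡i² +[1+ _ ]  = refl
∣i∣²≡i² -[1+ _ ]  = refl

n≤n² : ∀ n → n ℕ.≤ n ℕ.* n
n≤n² zero    = z≤n
n≤n² (suc n) = ℕₚ.m≤m*n (suc n) (suc n)

n²-injective : ∀ {m n} → m ℕ.* m ≡ n ℕ.* n → m ≡ n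
n²-injective {m} {n} m²≡n² with ℕₚ.<-cmp m n
... | tri< m<n _ _ = ⊥-elim (ℕₚ.<⇒≢ (ℕₚ.*-mono-< m<n m<n) m²≡n²)
... | tri≈ _ m≡n _ = m≡n
... | tri> _ _ n<m = ⊥-elim (ℕₚ.<⇒≢ (ℕₚ.*-mono-< n<m n<m) (sym m²≡n²))

square-injective : ∀ {m n} → + m * + m ≡ + n * + n → m ≡ n
square-injective {m} {n} eq = n²-injective (begin
  m ℕ.* m         ≡⟨ ℤₚ.abs-* (+ m) (+ m) ⟨
  ∣ + m * + m ∣   ≡⟨ cong ∣_∣ eq ⟩
  ∣ + n * + n ∣   ≡⟨ ℤₚ.abs-* (+ n) (+ n) ⟩
  n ℕ.* n         ∎)
  where open ≡-Reasoning

-- Anisotropy of x² - dy², a formulation that serves both signs of d. It keeps the value 0 off the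
-- river and makes 𝔻[d] an integral domain.
Irrational : ℤ → Set
Irrational d = ∀ x y → x * x ≡ d * (y * y) → y ≡ + 0

-- A basis α = p + r√D, β = q + s√D of ℤ[√D] on which the norm form is
-- N(Xα + Yβ) = (1 + a)X² + 2hXY - (1 + b)Y².
record IndefiniteBasis (D : ℤ) : Set where
  field
    p q r s a b : ℕ
    h  : ℤ
    αα : + p * + p - D * (+ r * + r) ≡ +[1+ a ]
    αβ : + p * + q - D * (+ r * + s) ≡ h
    ββ : D * (+ s * + s) - + q * + q ≡ +[1+ b ]
    det : + p * + s - + q * + r ≡ + 1

  -- A measure that grows at every step along the river, so that bases met at different times differ
  -- even when their forms agree.
  size : ℕ
  size = (p ℕ.+ q) ℕ.+ (r ℕ.+ s)

  -- A change of basis of determinant 1 preserves the discriminant. No term on the left is negative,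
  -- so for given `D` only finitely many triples `h`, `a`, `b` are possible.
  discriminant : h * h + +[1+ a ] * +[1+ b ] ≡ D
  discriminant = begin
    h * h + +[1+ a ] * +[1+ b ]
      ≡⟨ cong₂ (λ x y → x * x + y * +[1+ b ]) αβ αα ⟨
    (+ p * + q - D * (+ r * + s)) * (+ p * + q - D * (+ r * + s)) + (+ p * + p - D * (+ r * + r)) * +[1+ b ]
      ≡⟨ cong (λ y → (+ p * + q - D * (+ r * + s)) * (+ p * + q - D * (+ r * + s))
           + (+ p * + p - D * (+ r * + r)) * y) ββ ⟨
    _ ≡⟨ lemma (+ p) (+ q) (+ r) (+ s) D ⟩
    D * ((+ p * + s - + q * + r) * (+ p * + s - + q * + r)) ≡⟨ cong (λ z → D * (z * z)) det ⟩
    D * + 1 ≡⟨ ℤₚ.*-identityʳ D ⟩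
    D ∎
    where
    open ≡-Reasoning
    lemma : ∀ p q r s D →
      (p * q - D * (r * s)) * (p * q - D * (r * s)) + (p * p - D * (r * r)) * (D * (s * s) - q * q) ≡
      D * ((p * s - q * r) * (p * s - q * r))
    lemma = solve-∀

  -- N(s′α - r′β). If r′, s′ belong to a second basis with the same form, s′α - r′β is
  -- the unit carrying the second basis to the first.
  quotient-norm : ∀ r′ s′ →
    let x = + p * s′ - + q * r′; y = + r * s′ - + s * r′ in
    x * x - D * (y * y) ≡ +[1+ a ] * (s′ * s′) - + 2 * h * (r′ * s′) - +[1+ b ] * (r′ * r′)
  quotient-norm r′ s′ = begin
    _ ≡⟨ lemma (+ p) (+ q) (+ r) (+ s) D r′ s′ ⟩
    _ ≡⟨ cong₂ (λ x y → x * (s′ * s′) - + 2 * y * (r′ * s′) - (D * (+ s * + s) - + q * + q) * (r′ * r′)) αα αβ ⟩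
    _ ≡⟨ cong (λ z → +[1+ a ] * (s′ * s′) - + 2 * h * (r′ * s′) - z * (r′ * r′)) ββ ⟩
    _ ∎
    where
    open ≡-Reasoning
    lemma : ∀ p q r s D r′ s′ →
      (p * s′ - q * r′) * (p * s′ - q * r′) - D * ((r * s′ - s * r′) * (r * s′ - s * r′)) ≡
      (p * p - D * (r * r)) * (s′ * s′) - + 2 * (p * q - D * (r * s)) * (r′ * s′)
        - (D * (s * s) - q * q) * (r′ * r′)
    lemma = solve-∀

module _ {D : ℤ} (irr : Irrational D) where
  open IndefiniteBasis

  -- One step along the river of the form in Conway's topograph: α + β replaces α or β
  -- according to the sign of its norm.
  next : (B : IndefiniteBasis D) → ∃ λ (B′ : IndefiniteBasis D) → size B ℕ.< size B′
  next B = go (+[1+ a B ] + + 2 * h B - +[1+ b B ]) refl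
    where
    P Q R S : ℤ
    P = + p B; Q = + q B; R = + r B; S = + s B

    N[α+β] : (P + Q) * (P + Q) - D * ((R + S) * (R + S)) ≡ +[1+ a B ] + + 2 * h B - +[1+ b B ]
    N[α+β] = begin
      _ ≡⟨ lemma P Q R S D ⟩
      _ ≡⟨ cong₂ (λ x y → x + + 2 * y - (D * (S * S) - Q * Q)) (αα B) (αβ B) ⟩
      _ ≡⟨ cong (λ z → +[1+ a B ] + + 2 * h B - z) (ββ B) ⟩
      _ ∎
      where
      open ≡-Reasoning
      lemma : ∀ p q r s D → (p + q) * (p + q) - D * ((r + s) * (r + s)) ≡
        (p * p - D * (r * r)) + + 2 * (p * q - D * (r * s)) - (D * (s * s) - q * q)
      lemma = solve-∀

    -- A step adds `p + r` or `q + s` to the size. Both are positive because α and β have nonzero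
    -- norm.
    α≢0 : p B ℕ.+ r B ≢ 0
    α≢0 p+r≡0 with r B | ℕₚ.m+n≡0⇒m≡0 (p B) p+r≡0 | ℕₚ.m+n≡0⇒n≡0 (p B) p+r≡0 | αα B
    ... | _ | p≡0 | refl | eq rewrite p≡0 | ℤₚ.*-zeroʳ D = case eq of λ ()

    β≢0 : q B ℕ.+ s B ≢ 0
    β≢0 q+s≡0 with s B | ℕₚ.m+n≡0⇒m≡0 (q B) q+s≡0 | ℕₚ.m+n≡0⇒n≡0 (q B) q+s≡0 | ββ B
    ... | _ | q≡0 | refl | eq rewrite q≡0 | ℤₚ.*-zeroʳ D = case eq of λ ()

    go : ∀ v → +[1+ a B ] + + 2 * h B - +[1+ b B ] ≡ v → ∃ λ (B′ : IndefiniteBasis D) → size B ℕ.< size B′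
    -- If α + β had norm 0, irrationality would give `r + s` = 0, and then the determinant would be
    -- 0 instead of 1.
    go (+ zero) v≡0 = ⊥-elim (α+β≢0
      (ℤₚ.+-injective (irr (P + Q) (R + S) (ℤₚ.i-j≡0⇒i≡j _ _ (trans N[α+β] v≡0)))))
      where
      α+β≢0 : r B ℕ.+ s B ≢ 0
      α+β≢0 r+s≡0 with r B | s B | ℕₚ.m+n≡0⇒m≡0 (r B) r+s≡0 | ℕₚ.m+n≡0⇒n≡0 (r B) r+s≡0 | det B
      ... | _ | _ | refl | refl | eq rewrite ℤₚ.*-zeroʳ P | ℤₚ.*-zeroʳ Q = case eq of λ ()
    go +[1+ a′ ] v≡ = record
      { p = p B ℕ.+ q B ; q = q B ; r = r B ℕ.+ s B ; s = s B ; a = a′ ; b = b B ; h = h B - +[1+ b B ]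
      ; αα = trans N[α+β] v≡
      ; αβ = trans (αβ-lemma P Q R S D) (cong₂ _-_ (αβ B) (ββ B))
      ; ββ = ββ B
      ; det = trans (det-lemma P Q R S) (det B) }
      , ℕₚ.<-≤-trans (ℕₚ.m<m+n (size B) (ℕₚ.n≢0⇒n>0 β≢0)) (ℕₚ.≤-reflexive (size-lemma (p B) (q B) (r B) (s B)))
      where
      αβ-lemma : ∀ p q r s D →
        (p + q) * q - D * ((r + s) * s) ≡ (p * q - D * (r * s)) - (D * (s * s) - q * q)
      αβ-lemma = solve-∀
      det-lemma : ∀ p q r s → (p + q) * s - q * (r + s) ≡ p * s - q * r
      det-lemma = solve-∀
      size-lemma : ∀ p q r s →
        ((p ℕ.+ q) ℕ.+ (r ℕ.+ s)) ℕ.+ (q ℕ.+ s) ≡ ((p ℕ.+ q) ℕ.+ q) ℕ.+ ((r ℕ.+ s) ℕ.+ s)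
      size-lemma = ℕ-solve-∀
    go -[1+ b′ ] v≡ = record
      { p = p B ; q = p B ℕ.+ q B ; r = r B ; s = r B ℕ.+ s B ; a = a B ; b = b′ ; h = +[1+ a B ] + h B
      ; αα = αα B
      ; αβ = trans (αβ-lemma P Q R S D) (cong₂ _+_ (αα B) (αβ B))
      ; ββ = trans (ββ-lemma P Q R S D) (cong -_ (trans N[α+β] v≡))
      ; det = trans (det-lemma P Q R S) (det B) }
      , ℕₚ.<-≤-trans (ℕₚ.m<m+n (size B) (ℕₚ.n≢0⇒n>0 α≢0)) (ℕₚ.≤-reflexive (size-lemma (p B) (q B) (r B) (s B)))
      where
      αβ-lemma : ∀ p q r s D →
        p * (p + q) - D * (r * (r + s)) ≡ (p * p - D * (r * r)) + (p * q - D * (r * s))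
      αβ-lemma = solve-∀
      ββ-lemma : ∀ p q r s D →
        D * ((r + s) * (r + s)) - (p + q) * (p + q) ≡ - ((p + q) * (p + q) - D * ((r + s) * (r + s)))
      ββ-lemma = solve-∀
      det-lemma : ∀ p q r s → p * (r + s) - (p + q) * r ≡ p * s - q * r
      det-lemma = solve-∀
      size-lemma : ∀ p q r s →
        ((p ℕ.+ q) ℕ.+ (r ℕ.+ s)) ℕ.+ (p ℕ.+ r) ≡ (p ℕ.+ (p ℕ.+ q)) ℕ.+ (r ℕ.+ (r ℕ.+ s))
      size-lemma = ℕ-solve-∀

  iterate : IndefiniteBasis D → ℕ → IndefiniteBasis D
  iterate B zero    = B
  iterate B (suc n) = proj₁ (next (iterate B n))

  size-iterate-mono : ∀ B {m n} → m ℕ.< n → size (iterate B m) ℕ.< size (iterate B n)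
  size-iterate-mono B {m} {suc n} (s≤s m≤n) with ℕₚ.m≤n⇒m<n∨m≡n m≤n
  ... | inj₁ m<n  = ℕₚ.<-trans (size-iterate-mono B m<n) (proj₂ (next (iterate B n)))
  ... | inj₂ refl = proj₂ (next (iterate B n))

  SameForm : (B B′ : IndefiniteBasis D) → Set
  SameForm B B′ = a B ≡ a B′ × b B ≡ b B′ × h B ≡ h B′

  module _ (B B′ : IndefiniteBasis D) where
    X Y : ℤ
    X = + p B′ * + s B - + q B′ * + r B
    Y = + r B′ * + s B - + s B′ * + r B

    -- In the basis `B` the combination sα - rβ equals 1, by `det`. X + Y√D is the combination with
    -- the same coefficients in `B′`, and its norm depends only on these and on the form.
    unit-norm : SameForm B B′ → X * X - D * (Y * Y) ≡ + 1
    unit-norm (a≡a′ , b≡b′ , h≡h′) = begin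
      X * X - D * (Y * Y) ≡⟨ quotient-norm B′ (+ r B) (+ s B) ⟩
      form (a B′) (b B′) (h B′) ≡⟨ form-cong a≡a′ b≡b′ h≡h′ ⟨
      form (a B) (b B) (h B) ≡⟨ quotient-norm B (+ r B) (+ s B) ⟨
      _ ≡⟨ cong₂ (λ u v → u * u - D * (v * v)) (det B) (lemma (+ r B) (+ s B)) ⟩
      + 1 * + 1 - D * (+ 0 * + 0) ≡⟨ unit D ⟩
      + 1 ∎
      where
      open ≡-Reasoning
      form : ℕ → ℕ → ℤ → ℤ
      form a b h = +[1+ a ] * (+ s B * + s B) - + 2 * h * (+ r B * + s B) - +[1+ b ] * (+ r B * + r B)
      form-cong : ∀ {a a′ b b′ h h′} → a ≡ a′ → b ≡ b′ → h ≡ h′ → form a b h ≡ form a′ b′ h′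
      form-cong refl refl refl = refl
      lemma : ∀ r s → r * s - s * r ≡ + 0
      lemma = solve-∀
      unit : ∀ D → + 1 * + 1 - D * (+ 0 * + 0) ≡ + 1
      unit = solve-∀

    -- Y is the determinant of (r′ , s′) and (r , s), so its vanishing makes them proportional;
    -- `det` exhibits the factor as the integer `t`.
    Y≡0⇒∣ : Y ≡ + 0 → (r B ℕD.∣ r B′) × (s B ℕD.∣ s B′)
    Y≡0⇒∣ Y≡0 = multiple (r B) (r B′) r′≡tr , multiple (s B) (s B′) s′≡ts
      where
      open ≡-Reasoning
      t : ℤ
      t = + p B * + s B′ - + q B * + r B′
      multiple : ∀ m n → + n ≡ t * + m → m ℕD.∣ n
      multiple m n n≡tm = divides ∣ t ∣ (trans (cong ∣_∣ n≡tm) (ℤₚ.abs-* t (+ m)))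
      r′≡tr : + r B′ ≡ t * + r B
      r′≡tr = begin
        + r B′ ≡⟨ ℤₚ.*-identityʳ _ ⟨
        + r B′ * + 1 ≡⟨ cong (+ r B′ *_) (det B) ⟨
        _ ≡⟨ lemma (+ p B) (+ q B) (+ r B) (+ s B) (+ r B′) (+ s B′) ⟩
        + p B * Y + t * + r B ≡⟨ cong (λ z → + p B * z + t * + r B) Y≡0 ⟩
        + p B * + 0 + t * + r B ≡⟨ cong (_+ t * + r B) (ℤₚ.*-zeroʳ (+ p B)) ⟩
        + 0 + t * + r B ≡⟨ ℤₚ.+-identityˡ _ ⟩
        t * + r B ∎
        where
        lemma : ∀ p q r s r′ s′ →
          r′ * (p * s - q * r) ≡ p * (r′ * s - s′ * r) + (p * s′ - q * r′) * r
        lemma = solve-∀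
      s′≡ts : + s B′ ≡ t * + s B
      s′≡ts = begin
        + s B′ ≡⟨ ℤₚ.*-identityʳ _ ⟨
        + s B′ * + 1 ≡⟨ cong (+ s B′ *_) (det B) ⟨
        _ ≡⟨ lemma (+ p B) (+ q B) (+ r B) (+ s B) (+ r B′) (+ s B′) ⟩
        + q B * Y + t * + s B ≡⟨ cong (λ z → + q B * z + t * + s B) Y≡0 ⟩
        + q B * + 0 + t * + s B ≡⟨ cong (_+ t * + s B) (ℤₚ.*-zeroʳ (+ q B)) ⟩
        + 0 + t * + s B ≡⟨ ℤₚ.+-identityˡ _ ⟩
        t * + s B ∎
        where
        lemma : ∀ p q r s r′ s′ →
          s′ * (p * s - q * r) ≡ q * (r′ * s - s′ * r) + (p * s′ - q * r′) * s
        lemma = solve-∀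

  -- If the unit is ±1 then both bases have the same r and s, hence also the same p and q.
  Y≢0 : ∀ (B B′ : IndefiniteBasis D) → SameForm B B′ → size B ≢ size B′ → Y B B′ ≢ + 0
  Y≢0 B B′ (a≡a′ , b≡b′ , h≡h′) size≢ Y≡0 =
    size≢ (cong₂ ℕ._+_ (cong₂ ℕ._+_ p≡p′ q≡q′) (cong₂ ℕ._+_ r≡r′ s≡s′))
    where
    Y′≡0 : Y B′ B ≡ + 0
    Y′≡0 = trans (lemma (+ r B) (+ s B) (+ r B′) (+ s B′)) (cong -_ Y≡0)
      where
      lemma : ∀ r s r′ s′ → r * s′ - s * r′ ≡ - (r′ * s - s′ * r)
      lemma = solve-∀
    r≡r′ : r B ≡ r B′
    r≡r′ = ℕD.∣-antisym (proj₁ (Y≡0⇒∣ B B′ Y≡0)) (proj₁ (Y≡0⇒∣ B′ B Y′≡0))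
    s≡s′ : s B ≡ s B′
    s≡s′ = ℕD.∣-antisym (proj₂ (Y≡0⇒∣ B B′ Y≡0)) (proj₂ (Y≡0⇒∣ B′ B Y′≡0))
    p≡p′ : p B ≡ p B′
    p≡p′ = square-injective (ℤ-Group.∙-cancelʳ (- (D * (+ r B * + r B))) _ _ (begin
      + p B * + p B - D * (+ r B * + r B)     ≡⟨ αα B ⟩
      +[1+ a B ]                              ≡⟨ cong +[1+_] a≡a′ ⟩
      +[1+ a B′ ]                             ≡⟨ αα B′ ⟨
      + p B′ * + p B′ - D * (+ r B′ * + r B′) ≡⟨ cong (λ z → + p B′ * + p B′ - D * (+ z * + z)) r≡r′ ⟨
      + p B′ * + p B′ - D * (+ r B * + r B)   ∎))
      where open ≡-Reasoning
    q≡q′ : q B ≡ q B′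
    q≡q′ = square-injective (ℤₚ.neg-injective (ℤ-Group.∙-cancelˡ (D * (+ s B * + s B)) _ _ (begin
      D * (+ s B * + s B) - + q B * + q B     ≡⟨ ββ B ⟩
      +[1+ b B ]                              ≡⟨ cong +[1+_] b≡b′ ⟩
      +[1+ b B′ ]                             ≡⟨ ββ B′ ⟨
      D * (+ s B′ * + s B′) - + q B′ * + q B′ ≡⟨ cong (λ z → D * (+ z * + z) - + q B′ * + q B′) s≡s′ ⟨
      D * (+ s B * + s B) - + q B′ * + q B′   ∎)))
      where open ≡-Reasoning

-- Finiteness of the set of forms and the solution of Pell's equation

signBit : Sign → Fin 2
signBit Sign.+ = fzero
signBit Sign.- = fsuc fzero

signBit-injective : ∀ {σ τ} → signBit σ ≡ signBit τ → σ ≡ τ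
signBit-injective {Sign.+} {Sign.+} _ = refl
signBit-injective {Sign.-} {Sign.-} _ = refl

module _ {K : ℕ} where
  encode : Sign → ∀ {x y z} → x ℕ.< K → y ℕ.< K → z ℕ.< K → Fin ((2 ℕ.* K) ℕ.* (K ℕ.* K))
  encode σ x<K y<K z<K =
    combine (combine (signBit σ) (fromℕ< x<K)) (combine (fromℕ< y<K) (fromℕ< z<K))

  encode-injective : ∀ σ σ′ {x x′ y y′ z z′}
    (x<K : x ℕ.< K) (y<K : y ℕ.< K) (z<K : z ℕ.< K)
    (x′<K : x′ ℕ.< K) (y′<K : y′ ℕ.< K) (z′<K : z′ ℕ.< K) →
    encode σ x<K y<K z<K ≡ encode σ′ x′<K y′<K z′<K → (σ ≡ σ′ × x ≡ x′) × (y ≡ y′ × z ≡ z′)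
  encode-injective σ σ′ x<K y<K z<K x′<K y′<K z′<K eq
    with combine-injective (combine (signBit σ) (fromℕ< x<K)) (combine (fromℕ< y<K) (fromℕ< z<K))
           (combine (signBit σ′) (fromℕ< x′<K)) (combine (fromℕ< y′<K) (fromℕ< z′<K)) eq
  ... | eq₁ , eq₂
    with combine-injective (signBit σ) (fromℕ< x<K) (signBit σ′) (fromℕ< x′<K) eq₁
       | combine-injective (fromℕ< y<K) (fromℕ< z<K) (fromℕ< y′<K) (fromℕ< z′<K) eq₂
  ... | eqσ , eqx | eqy , eqz =
    (signBit-injective eqσ , fromℕ<-injective _ _ x<K x′<K eqx)
    , (fromℕ<-injective _ _ y<K y′<K eqy , fromℕ<-injective _ _ z<K z′<K eqz)

module _ {D : ℕ} (B : IndefiniteBasis +[1+ D ]) where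
  open IndefiniteBasis B

  abs-discriminant : ∣ h ∣ ℕ.* ∣ h ∣ ℕ.+ suc a ℕ.* suc b ≡ suc D
  abs-discriminant = ℤₚ.+-injective (trans (cong (_+ +[1+ a ] * +[1+ b ]) (∣i∣²≡i² h)) discriminant)

  ∣h∣<2+D : ∣ h ∣ ℕ.< suc (suc D)
  ∣h∣<2+D = s≤s (ℕₚ.≤-trans (n≤n² ∣ h ∣) (ℕₚ.≤-trans (ℕₚ.m≤m+n _ _) (ℕₚ.≤-reflexive abs-discriminant)))

  a<2+D : a ℕ.< suc (suc D)
  a<2+D = ℕₚ.m≤n⇒m≤1+n (ℕₚ.≤-trans (ℕₚ.m≤m*n (suc a) (suc b))
    (ℕₚ.≤-trans (ℕₚ.m≤n+m _ (∣ h ∣ ℕ.* ∣ h ∣)) (ℕₚ.≤-reflexive abs-discriminant)))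

  b<2+D : b ℕ.< suc (suc D)
  b<2+D = ℕₚ.m≤n⇒m≤1+n (ℕₚ.≤-trans (ℕₚ.m≤n*m (suc b) (suc a))
    (ℕₚ.≤-trans (ℕₚ.m≤n+m _ (∣ h ∣ ℕ.* ∣ h ∣)) (ℕₚ.≤-reflexive abs-discriminant)))

module _ {D : ℕ} (irr : Irrational +[1+ D ]) where
  open IndefiniteBasis

  -- K is a variable so that the index of Fin does not unfold.
  module _ {K : ℕ} (K≡2+D : K ≡ suc (suc D)) where
    to<K : ∀ {n} → n ℕ.< suc (suc D) → n ℕ.< K
    to<K {n} = subst (n ℕ.<_) (sym K≡2+D)

    formCode : IndefiniteBasis +[1+ D ] → Fin ((2 ℕ.* K) ℕ.* (K ℕ.* K))
    formCode B = encode (sign (h B)) (to<K (∣h∣<2+D B)) (to<K (a<2+D B)) (to<K (b<2+D B))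

    formCode-injective : ∀ B B′ → formCode B ≡ formCode B′ → SameForm irr B B′
    formCode-injective B B′ eq = proj₁ (proj₂ codes) , proj₂ (proj₂ codes) ,
      trans (sym (ℤₚ.◃-inverse (h B)))
        (trans (cong₂ _◃_ (proj₁ (proj₁ codes)) (proj₂ (proj₁ codes))) (ℤₚ.◃-inverse (h B′)))
      where
      codes : (sign (h B) ≡ sign (h B′) × ∣ h B ∣ ≡ ∣ h B′ ∣) × (a B ≡ a B′ × b B ≡ b B′)
      codes = encode-injective (sign (h B)) (sign (h B′))
        (to<K (∣h∣<2+D B)) (to<K (a<2+D B)) (to<K (b<2+D B))
        (to<K (∣h∣<2+D B′)) (to<K (a<2+D B′)) (to<K (b<2+D B′)) eq

    collision : (f : ℕ → IndefiniteBasis +[1+ D ]) → ∃₂ λ i j → i ℕ.< j × SameForm irr (f i) (f j)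
    collision f =
      let i , j , i<j , eq = pigeonhole (ℕₚ.n<1+n _) (λ i → formCode (f (toℕ i)))
      in toℕ i , toℕ j , i<j , formCode-injective (f (toℕ i)) (f (toℕ j)) eq

  standardBasis : IndefiniteBasis +[1+ D ]
  standardBasis = record
    { p = 1 ; q = 0 ; r = 0 ; s = 1 ; a = 0 ; b = D ; h = + 0
    ; αα = cong (λ z → + 1 - z) (ℤₚ.*-zeroʳ +[1+ D ])
    ; αβ = cong (λ z → + 0 - z) (ℤₚ.*-zeroʳ +[1+ D ])
    ; ββ = trans (ℤₚ.+-identityʳ _) (ℤₚ.*-identityʳ +[1+ D ])
    ; det = refl }

  -- Some form occurs twice along the river. The two bases differ by a unit of norm 1, and their
  -- different sizes force y ≠ 0.
  pell : ∃₂ λ x y → y ≢ + 0 × x * x - +[1+ D ] * (y * y) ≡ + 1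
  pell =
    let i , j , i<j , same = collision refl (iterate irr standardBasis)
        B  = iterate irr standardBasis i
        B′ = iterate irr standardBasis j
    in X irr B B′ , Y irr B B′
     , Y≢0 irr B B′ same (ℕₚ.<⇒≢ (size-iterate-mono irr standardBasis i<j)) , unit-norm irr B B′ same

-- Arithmetic of 𝔻[d]

module Arithmetic (d : ℤ) where
  open Ring d

  ⊖_ : 𝔻 → 𝔻
  ⊖ (a , b) = (- a , - b)

  𝟙 : 𝔻
  𝟙 = (+ 1 , + 0)

  𝔻-isCommutativeRing : IsCommutativeRing _≡_ _⊕_ _⊗_ ⊖_ 𝟘 𝟙
  𝔻-isCommutativeRing = record
    { isRing = record
      { +-isAbelianGroup = record
        { isGroup = record
          { isMonoid = record
            { isSemigroup = record
              { isMagma = record { isEquivalence = isEquivalence ; ∙-cong = cong₂ _⊕_ }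
              ; assoc = λ x y z → cong₂ _,_ (ℤₚ.+-assoc (proj₁ x) _ _) (ℤₚ.+-assoc (proj₂ x) _ _) }
            ; identity = (λ x → cong₂ _,_ (ℤₚ.+-identityˡ _) (ℤₚ.+-identityˡ _))
                       , (λ x → cong₂ _,_ (ℤₚ.+-identityʳ _) (ℤₚ.+-identityʳ _)) }
          ; inverse = (λ x → cong₂ _,_ (ℤₚ.+-inverseˡ (proj₁ x)) (ℤₚ.+-inverseˡ (proj₂ x)))
                    , (λ x → cong₂ _,_ (ℤₚ.+-inverseʳ (proj₁ x)) (ℤₚ.+-inverseʳ (proj₂ x)))
          ; ⁻¹-cong = cong ⊖_ }
        ; comm = λ x y → cong₂ _,_ (ℤₚ.+-comm (proj₁ x) _) (ℤₚ.+-comm (proj₂ x) _) }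
      ; *-cong = cong₂ _⊗_
      ; *-assoc = λ (a , b) (a′ , b′) (a″ , b″) →
          cong₂ _,_ (assoc₁ a b a′ b′ a″ b″ (ωc₀ d) (ωc₁ d)) (assoc₂ a b a′ b′ a″ b″ (ωc₀ d) (ωc₁ d))
      ; *-identity = (λ (a , b) → cong₂ _,_ (idˡ₁ a b (ωc₀ d)) (idˡ₂ a b (ωc₁ d)))
                   , (λ (a , b) → cong₂ _,_ (idʳ₁ a b (ωc₀ d)) (idʳ₂ a b (ωc₁ d)))
      ; distrib = (λ (a , b) (a′ , b′) (a″ , b″) →
                    cong₂ _,_ (distribˡ₁ a b a′ b′ a″ b″ (ωc₀ d)) (distribˡ₂ a b a′ b′ a″ b″ (ωc₁ d)))
                , (λ (a , b) (a′ , b′) (a″ , b″) →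
                    cong₂ _,_ (distribʳ₁ a b a′ b′ a″ b″ (ωc₀ d)) (distribʳ₂ a b a′ b′ a″ b″ (ωc₁ d))) }
    ; *-comm = λ (a , b) (a′ , b′) → cong₂ _,_ (comm₁ a b a′ b′ (ωc₀ d)) (comm₂ a b a′ b′ (ωc₁ d)) }
    where
    assoc₁ : ∀ a b a′ b′ a″ b″ c₀ c₁ →
      (a * a′ + b * b′ * c₀) * a″ + (a * b′ + b * a′ + b * b′ * c₁) * b″ * c₀ ≡
      a * (a′ * a″ + b′ * b″ * c₀) + b * (a′ * b″ + b′ * a″ + b′ * b″ * c₁) * c₀
    assoc₁ = solve-∀
    assoc₂ : ∀ a b a′ b′ a″ b″ c₀ c₁ →
      (a * a′ + b * b′ * c₀) * b″ + (a * b′ + b * a′ + b * b′ * c₁) * a″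
        + (a * b′ + b * a′ + b * b′ * c₁) * b″ * c₁ ≡
      a * (a′ * b″ + b′ * a″ + b′ * b″ * c₁) + b * (a′ * a″ + b′ * b″ * c₀)
        + b * (a′ * b″ + b′ * a″ + b′ * b″ * c₁) * c₁
    assoc₂ = solve-∀
    idˡ₁ : ∀ a b c₀ → + 1 * a + + 0 * b * c₀ ≡ a
    idˡ₁ = solve-∀
    idˡ₂ : ∀ a b c₁ → + 1 * b + + 0 * a + + 0 * b * c₁ ≡ b
    idˡ₂ = solve-∀
    idʳ₁ : ∀ a b c₀ → a * + 1 + b * + 0 * c₀ ≡ a
    idʳ₁ = solve-∀
    idʳ₂ : ∀ a b c₁ → a * + 0 + b * + 1 + b * + 0 * c₁ ≡ b
    idʳ₂ = solve-∀
    distribˡ₁ : ∀ a b a′ b′ a″ b″ c₀ →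
      a * (a′ + a″) + b * (b′ + b″) * c₀ ≡ (a * a′ + b * b′ * c₀) + (a * a″ + b * b″ * c₀)
    distribˡ₁ = solve-∀
    distribˡ₂ : ∀ a b a′ b′ a″ b″ c₁ →
      a * (b′ + b″) + b * (a′ + a″) + b * (b′ + b″) * c₁ ≡
      (a * b′ + b * a′ + b * b′ * c₁) + (a * b″ + b * a″ + b * b″ * c₁)
    distribˡ₂ = solve-∀
    distribʳ₁ : ∀ a b a′ b′ a″ b″ c₀ →
      (a′ + a″) * a + (b′ + b″) * b * c₀ ≡ (a′ * a + b′ * b * c₀) + (a″ * a + b″ * b * c₀)
    distribʳ₁ = solve-∀
    distribʳ₂ : ∀ a b a′ b′ a″ b″ c₁ →
      (a′ + a″) * b + (b′ + b″) * a + (b′ + b″) * b * c₁ ≡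
      (a′ * b + b′ * a + b′ * b * c₁) + (a″ * b + b″ * a + b″ * b * c₁)
    distribʳ₂ = solve-∀
    comm₁ : ∀ a b a′ b′ c₀ → a * a′ + b * b′ * c₀ ≡ a′ * a + b′ * b * c₀
    comm₁ = solve-∀
    comm₂ : ∀ a b a′ b′ c₁ → a * b′ + b * a′ + b * b′ * c₁ ≡ a′ * b + b′ * a + b′ * b * c₁
    comm₂ = solve-∀

  𝔻-commutativeRing : CommutativeRing 0ℓ 0ℓ
  𝔻-commutativeRing = record { isCommutativeRing = 𝔻-isCommutativeRing }

  norm-⊗ : ∀ x y → norm (x ⊗ y) ≡ norm x * norm y
  norm-⊗ (a , b) (a′ , b′) = lemma a b a′ b′ (ωc₀ d) (ωc₁ d)
    where
    lemma : ∀ a b a′ b′ c₀ c₁ →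
      let A = a * a′ + b * b′ * c₀; B = a * b′ + b * a′ + b * b′ * c₁ in
      A * A + c₁ * A * B - c₀ * B * B ≡
      (a * a + c₁ * a * b - c₀ * b * b) * (a′ * a′ + c₁ * a′ * b′ - c₀ * b′ * b′)
    lemma = solve-∀

  conj : 𝔻 → 𝔻
  conj (a , b) = (a + ωc₁ d * b , - b)

  ⊗-conj : ∀ x → x ⊗ conj x ≡ (norm x , + 0)
  ⊗-conj (a , b) = cong₂ _,_ (lemma₁ a b (ωc₀ d) (ωc₁ d)) (lemma₂ a b (ωc₁ d))
    where
    lemma₁ : ∀ a b c₀ c₁ → a * (a + c₁ * b) + b * - b * c₀ ≡ a * a + c₁ * a * b - c₀ * b * b
    lemma₁ = solve-∀
    lemma₂ : ∀ a b c₁ → a * - b + b * (a + c₁ * b) + b * - b * c₁ ≡ + 0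
    lemma₂ = solve-∀

-- In lowest terms the denominator y′ divides x′², hence x′ by coprimality, and so it is 1.
rational-root-integral : ∀ m x y → y ≢ 0 → x ℕ.* x ≡ m ℕ.* (y ℕ.* y) → ∃ λ k → m ≡ k ℕ.* k
rational-root-integral m x y y≢0 x²≡my² = x′ , (begin
  m                   ≡⟨ ℕₚ.*-identityʳ m ⟨
  m ℕ.* (1 ℕ.* 1)     ≡⟨ cong (λ z → m ℕ.* (z ℕ.* z)) y′≡1 ⟨
  m ℕ.* (y′ ℕ.* y′)   ≡⟨ x′²≡my′² ⟨
  x′ ℕ.* x′           ∎)
  where
  open ≡-Reasoning
  g : ℕ
  g = gcd x y
  instance
    g≢0 : ℕ.NonZero g
    g≢0 = ℕ.≢-nonZero (GCD.gcd[m,n]≢0 x y (inj₂ y≢0))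
  x′ y′ : ℕ
  x′ = x ℕDM./ g
  y′ = y ℕDM./ g
  x≡ : x ≡ x′ ℕ.* g
  x≡ = sym (ℕDM.m/n*n≡m (GCD.gcd[m,n]∣m x y))
  y≡ : y ≡ y′ ℕ.* g
  y≡ = sym (ℕDM.m/n*n≡m (GCD.gcd[m,n]∣n x y))
  regroup : ∀ m y g → m ℕ.* ((y ℕ.* g) ℕ.* (y ℕ.* g)) ≡ (m ℕ.* (y ℕ.* y)) ℕ.* (g ℕ.* g)
  regroup = ℕ-solve-∀
  regroup′ : ∀ x g → (x ℕ.* g) ℕ.* (x ℕ.* g) ≡ (x ℕ.* x) ℕ.* (g ℕ.* g)
  regroup′ = ℕ-solve-∀
  x′²≡my′² : x′ ℕ.* x′ ≡ m ℕ.* (y′ ℕ.* y′)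
  x′²≡my′² = ℕₚ.*-cancelʳ-≡ _ _ (g ℕ.* g) {{ℕₚ.m*n≢0 g g}} (begin
    (x′ ℕ.* x′) ℕ.* (g ℕ.* g)          ≡⟨ regroup′ x′ g ⟨
    (x′ ℕ.* g) ℕ.* (x′ ℕ.* g)          ≡⟨ cong (λ z → z ℕ.* z) x≡ ⟨
    x ℕ.* x                            ≡⟨ x²≡my² ⟩
    m ℕ.* (y ℕ.* y)                    ≡⟨ cong (λ z → m ℕ.* (z ℕ.* z)) y≡ ⟩
    m ℕ.* ((y′ ℕ.* g) ℕ.* (y′ ℕ.* g))  ≡⟨ regroup m y′ g ⟩
    (m ℕ.* (y′ ℕ.* y′)) ℕ.* (g ℕ.* g)  ∎)
  coprime : Coprime.Coprime x′ y′
  coprime = Coprime.coprime-/gcd x y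
  y′∣x′ : y′ ℕD.∣ x′
  y′∣x′ = coprime-divisor (Coprime.sym coprime)
    (divides (m ℕ.* y′) (trans x′²≡my′² (sym (ℕₚ.*-assoc m y′ y′))))
  y′≡1 : y′ ≡ 1
  y′≡1 = coprime (y′∣x′ , ℕD.∣-refl)

-- A solution with y ≠ 0 makes |d| a square, hence 1 by squarefreeness. This leaves d = -1, where
-- the signs of the two sides disagree.
squarefree⇒irrational : ∀ d → Squarefree d → d ≢ + 1 → Irrational d
squarefree⇒irrational d squarefree d≢1 x y x²≡dy² =
  decidable-stable (y ℤₚ.≟ + 0) λ y≢0 → ±1-impossible y≢0 d (∣d∣≡1 y≢0) d≢1 x²≡dy²
  where
  ∣x∣²≡∣d∣∣y∣² : ∣ x ∣ ℕ.* ∣ x ∣ ≡ ∣ d ∣ ℕ.* (∣ y ∣ ℕ.* ∣ y ∣)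
  ∣x∣²≡∣d∣∣y∣² = begin
    ∣ x ∣ ℕ.* ∣ x ∣              ≡⟨ ℤₚ.abs-* x x ⟨
    ∣ x * x ∣                    ≡⟨ cong ∣_∣ x²≡dy² ⟩
    ∣ d * (y * y) ∣              ≡⟨ ℤₚ.abs-* d (y * y) ⟩
    ∣ d ∣ ℕ.* ∣ y * y ∣          ≡⟨ cong (∣ d ∣ ℕ.*_) (ℤₚ.abs-* y y) ⟩
    ∣ d ∣ ℕ.* (∣ y ∣ ℕ.* ∣ y ∣)  ∎
    where open ≡-Reasoning
  ∣d∣≡1 : y ≢ + 0 → ∣ d ∣ ≡ 1
  ∣d∣≡1 y≢0 =
    let k , ∣d∣≡k² = rational-root-integral (∣ d ∣) (∣ x ∣) (∣ y ∣) (y≢0 ∘ ℤₚ.∣i∣≡0⇒i≡0) ∣x∣²≡∣d∣∣y∣²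
    in trans ∣d∣≡k² (cong (λ z → z ℕ.* z)
         (squarefree k (divides 1 (trans ∣d∣≡k² (sym (ℕₚ.*-identityˡ (k ℕ.* k)))))))
  -1-impossible : ∀ x y → y ≢ + 0 → x * x ≢ -[1+ 0 ] * (y * y)
  -1-impossible x        (+ zero)  y≢0 _ = y≢0 refl
  -1-impossible (+ zero) +[1+ _ ]  _   ()
  -1-impossible +[1+ _ ] +[1+ _ ]  _   ()
  -1-impossible -[1+ _ ] +[1+ _ ]  _   ()
  -1-impossible (+ zero) -[1+ _ ]  _   ()
  -1-impossible +[1+ _ ] -[1+ _ ]  _   ()
  -1-impossible -[1+ _ ] -[1+ _ ]  _   ()
  ±1-impossible : y ≢ + 0 → ∀ d → ∣ d ∣ ≡ 1 → d ≢ + 1 → x * x ≢ d * (y * y)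
  ±1-impossible _   (+ 1)    refl d≢1 _  = d≢1 refl
  ±1-impossible y≢0 -[1+ 0 ] refl _   eq = -1-impossible x y y≢0 eq

-- `ωc₀` uses floor division. For d ≡ 1 modulo 4 it is exact, because the remainder of d - 1 is a
-- multiple of 4 below 4.
ω-cases : ∀ d → (ωc₁ d ≡ + 1 × + 4 * ωc₀ d + + 1 ≡ d) ⊎ (ωc₁ d ≡ + 0 × ωc₀ d ≡ d)
ω-cases d with d %ℕ 4 in d%4≡
... | 0 = inj₂ (refl , refl)
... | suc (suc _) = inj₂ (refl , refl)
... | 1 = inj₁ (refl , (begin
    + 4 * q′ + + 1      ≡⟨ rearrange q′ ⟩
    + 0 + q′ * + 4 + + 1  ≡⟨ cong (λ r → + r + q′ * + 4 + + 1) (r≡0 ((d - + 1) %ℕ 4) (n%ℕd<d (d - + 1) 4) r≡) ⟨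
    + ((d - + 1) %ℕ 4) + q′ * + 4 + + 1 ≡⟨ cong (_+ + 1) (a≡a%ℕn+[a/ℕn]*n (d - + 1) 4) ⟨
    d - + 1 + + 1       ≡⟨ cancel d ⟩
    d                   ∎))
  where
  open ≡-Reasoning
  q q′ : ℤ
  q = d /ℕ 4
  q′ = (d - + 1) /ℕ 4
  rearrange : ∀ q → + 4 * q + + 1 ≡ + 0 + q * + 4 + + 1
  rearrange = solve-∀
  cancel : ∀ d → d - + 1 + + 1 ≡ d
  cancel = solve-∀
  r≡ : + ((d - + 1) %ℕ 4) ≡ (q - q′) * + 4
  r≡ = begin
    + ((d - + 1) %ℕ 4) ≡⟨ insert (+ ((d - + 1) %ℕ 4)) q′ ⟩
    + ((d - + 1) %ℕ 4) + q′ * + 4 - q′ * + 4 ≡⟨ cong (_- q′ * + 4) (a≡a%ℕn+[a/ℕn]*n (d - + 1) 4) ⟨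
    d - + 1 - q′ * + 4 ≡⟨ cong (λ z → z - + 1 - q′ * + 4) (a≡a%ℕn+[a/ℕn]*n d 4) ⟩
    + (d %ℕ 4) + q * + 4 - + 1 - q′ * + 4 ≡⟨ cong (λ z → + z + q * + 4 - + 1 - q′ * + 4) d%4≡ ⟩
    + 1 + q * + 4 - + 1 - q′ * + 4 ≡⟨ collect q q′ ⟩
    (q - q′) * + 4 ∎
    where
    insert : ∀ r q′ → r ≡ r + q′ * + 4 - q′ * + 4
    insert = solve-∀
    collect : ∀ q q′ → + 1 + q * + 4 - + 1 - q′ * + 4 ≡ (q - q′) * + 4
    collect = solve-∀
  r≡0 : ∀ r → r ℕ.< 4 → + r ≡ (q - q′) * + 4 → r ≡ 0
  r≡0 r r<4 r≡z4 with ∣ q - q′ ∣ | trans (cong ∣_∣ r≡z4) (ℤₚ.abs-* (q - q′) (+ 4))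
  ... | zero  | eq = eq
  ... | suc k | eq = ⊥-elim (ℕₚ.<⇒≱ r<4 (ℕₚ.≤-trans (ℕₚ.m≤m+n 4 (k ℕ.* 4)) (ℕₚ.≤-reflexive (sym eq))))

-- The integral domain 𝔻[d] and the decomposition of 4/n

module Domain (d : ℤ) (irrational : Irrational d) where
  open Ring d
  open Arithmetic d
  open CommutativeRing 𝔻-commutativeRing using (zeroˡ; commutativeSemiring)
  open SemiringIdentities commutativeSemiring

  -- Reduces to irrationality: the norm is a² - db² when ω = √d, and otherwise four times the norm
  -- is (2a + b)² - db².
  norm≡0⇒≡0 : ∀ x → norm x ≡ + 0 → x ≡ 𝟘
  norm≡0⇒≡0 (a , b) norm≡0 = cong₂ _,_ a≡0 b≡0
    where
    open ≡-Reasoning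
    b≡0 : b ≡ + 0
    b≡0 with ω-cases d
    ... | inj₁ (c₁≡1 , 4c₀+1≡d) = irrational (+ 2 * a + b) b (begin
      (+ 2 * a + b) * (+ 2 * a + b) ≡⟨ complete-square a b (ωc₀ d) ⟩
      + 4 * (a * a + + 1 * a * b - ωc₀ d * b * b) + (+ 4 * ωc₀ d + + 1) * (b * b)
        ≡⟨ cong (λ c → + 4 * (a * a + c * a * b - ωc₀ d * b * b) + (+ 4 * ωc₀ d + + 1) * (b * b)) c₁≡1 ⟨
      + 4 * norm (a , b) + (+ 4 * ωc₀ d + + 1) * (b * b)
        ≡⟨ cong₂ (λ u v → + 4 * u + v * (b * b)) norm≡0 4c₀+1≡d ⟩
      + 0 + d * (b * b) ≡⟨ ℤₚ.+-identityˡ _ ⟩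
      d * (b * b) ∎)
      where
      complete-square : ∀ a b c → (+ 2 * a + b) * (+ 2 * a + b) ≡
        + 4 * (a * a + + 1 * a * b - c * b * b) + (+ 4 * c + + 1) * (b * b)
      complete-square = solve-∀
    ... | inj₂ (c₁≡0 , c₀≡d) = irrational a b (begin
      a * a ≡⟨ rearrange a b d ⟩
      a * a + + 0 * a * b - d * b * b + d * (b * b)
        ≡⟨ cong₂ (λ c e → a * a + c * a * b - e * b * b + d * (b * b)) c₁≡0 c₀≡d ⟨
      norm (a , b) + d * (b * b) ≡⟨ cong (_+ d * (b * b)) norm≡0 ⟩
      + 0 + d * (b * b) ≡⟨ ℤₚ.+-identityˡ _ ⟩
      d * (b * b) ∎)
      where
      rearrange : ∀ a b d → a * a ≡ a * a + + 0 * a * b - d * b * b + d * (b * b)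
      rearrange = solve-∀
    a*a≡0 : a * a ≡ + 0
    a*a≡0 = begin
      a * a ≡⟨ insert a (ωc₀ d) (ωc₁ d) ⟩
      a * a + ωc₁ d * a * + 0 - ωc₀ d * + 0 * + 0 ≡⟨ cong (λ z → a * a + ωc₁ d * a * z - ωc₀ d * z * z) b≡0 ⟨
      norm (a , b) ≡⟨ norm≡0 ⟩
      + 0 ∎
      where
      insert : ∀ a c₀ c₁ → a * a ≡ a * a + c₁ * a * + 0 - c₀ * + 0 * + 0
      insert = solve-∀
    a≡0 : a ≡ + 0
    a≡0 = [ (λ z → z) , (λ z → z) ]′ (ℤₚ.i*j≡0⇒i≡0∨j≡0 a a*a≡0)

  ⊗-≢𝟘 : ∀ {x y} → x ≢ 𝟘 → y ≢ 𝟘 → x ⊗ y ≢ 𝟘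
  ⊗-≢𝟘 {x} {y} x≢0 y≢0 xy≡0 =
    [ x≢0 ∘ norm≡0⇒≡0 x , y≢0 ∘ norm≡0⇒≡0 y ]′ (ℤₚ.i*j≡0⇒i≡0∨j≡0 (norm x) (begin
      norm x * norm y ≡⟨ norm-⊗ x y ⟨
      norm (x ⊗ y)    ≡⟨ cong norm xy≡0 ⟩
      norm 𝟘          ≡⟨ norm-𝟘 (ωc₀ d) (ωc₁ d) ⟩
      + 0             ∎))
    where
    open ≡-Reasoning
    norm-𝟘 : ∀ c₀ c₁ → + 0 * + 0 + c₁ * + 0 * + 0 - c₀ * + 0 * + 0 ≡ + 0
    norm-𝟘 = solve-∀

  factor-≢𝟘 : ∀ x y {z} → x ⊗ y ≡ z → z ≢ 𝟘 → x ≢ 𝟘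
  factor-≢𝟘 x y xy≡z z≢0 x≡0 = z≢0 (trans (sym xy≡z) (trans (cong (_⊗ y) x≡0) (zeroˡ y)))

  -- What has to be added to the identity is that the denominators do not vanish; p′ and q′ inherit
  -- this from nk.
  split : ∀ {n k f g p q p′ q′} → 𝟜 ⊗ k ≡ n ⊕ f → p ⊕ q ≡ g ⊗ f →
    p′ ⊗ p ≡ n ⊗ k → q′ ⊗ q ≡ n ⊗ k → n ≢ 𝟘 → k ≢ 𝟘 → g ≢ 𝟘 → ErdosStraus d n
  split {n} {k} {f} {g} {p} {q} {p′} {q′} 4k≡n+f p+q≡gf p′p≡nk q′q≡nk n≢0 k≢0 g≢0 =
    k , g ⊗ p′ , g ⊗ q′ , k≢0
    , ⊗-≢𝟘 g≢0 (factor-≢𝟘 p′ p p′p≡nk (⊗-≢𝟘 n≢0 k≢0))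
    , ⊗-≢𝟘 g≢0 (factor-≢𝟘 q′ q q′q≡nk (⊗-≢𝟘 n≢0 k≢0))
    , split-identity {𝟜} {n} {k} {f} {g} {p} {q} {p′} {q′} 4k≡n+f p+q≡gf p′p≡nk q′q≡nk

  -- The element x + t√d; note that √d = - c₁ + (1 + c₁) ω, as c₁ ∈ {0, 1}.
  withRoot : ℤ → ℤ → 𝔻
  withRoot x t = (x - t * ωc₁ d , t * (+ 1 + ωc₁ d))

  -- The factors are conjugate, so a solution of Pell's equation makes them mutually inverse units.
  withRoot-norm : ∀ x t → withRoot x (- t) ⊗ withRoot x t ≡ (x * x - d * (t * t) , + 0)
  withRoot-norm x t = cong₂ _,_
    (trans (expand₁ x t (ωc₀ d) (ωc₁ d)) (cong (λ z → x * x - z * (t * t)) √d²))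
    (trans (expand₂ x t (ωc₁ d))
      (trans (cong (t * t * (+ 1 + ωc₁ d) *_) c₁-idempotent) (ℤₚ.*-zeroʳ (t * t * (+ 1 + ωc₁ d)))))
    where
    expand₁ : ∀ x t c₀ c₁ →
      (x - - t * c₁) * (x - t * c₁) + - t * (+ 1 + c₁) * (t * (+ 1 + c₁)) * c₀ ≡
      x * x - (c₁ * c₁ + (+ 1 + c₁) * (+ 1 + c₁) * c₀) * (t * t)
    expand₁ = solve-∀
    expand₂ : ∀ x t c₁ →
      (x - - t * c₁) * (t * (+ 1 + c₁)) + - t * (+ 1 + c₁) * (x - t * c₁)
        + - t * (+ 1 + c₁) * (t * (+ 1 + c₁)) * c₁ ≡
      t * t * (+ 1 + c₁) * (c₁ * (+ 1 - c₁))
    expand₂ = solve-∀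
    √d² : ωc₁ d * ωc₁ d + (+ 1 + ωc₁ d) * (+ 1 + ωc₁ d) * ωc₀ d ≡ d
    √d² with ω-cases d
    ... | inj₁ (c₁≡1 , 4c₀+1≡d) = trans (cong (λ c → c * c + (+ 1 + c) * (+ 1 + c) * ωc₀ d) c₁≡1)
            (trans (ℤₚ.+-comm (+ 1) (+ 4 * ωc₀ d)) 4c₀+1≡d)
    ... | inj₂ (c₁≡0 , c₀≡d) = trans (cong (λ c → c * c + (+ 1 + c) * (+ 1 + c) * ωc₀ d) c₁≡0)
            (trans (trans (ℤₚ.+-identityˡ _) (ℤₚ.*-identityˡ _)) c₀≡d)
    c₁-idempotent : ωc₁ d * (+ 1 - ωc₁ d) ≡ + 0
    c₁-idempotent with ω-cases d
    ... | inj₁ (c₁≡1 , _) = cong (λ c → c * (+ 1 - c)) c₁≡1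
    ... | inj₂ (c₁≡0 , _) = cong (λ c → c * (+ 1 - c)) c₁≡0

-- Real fields

_≟𝔻_ : (x y : 𝔻) → Dec (x ≡ y)
(a , b) ≟𝔻 (a′ , b′) = map′ (λ (p , q) → cong₂ _,_ p q) (λ eq → cong proj₁ eq , cong proj₂ eq)
  ((a ℤₚ.≟ a′) ×-dec (b ℤₚ.≟ b′))

module RealCase (m : ℕ) (irrational : Irrational +[1+ m ]) where
  d : ℤ
  d = +[1+ m ]
  open Ring d
  open Arithmetic d
  open Domain d irrational
  open CommutativeRing 𝔻-commutativeRing using (*-comm; *-assoc; *-identityˡ)

  -- A unit x + yR√d which is congruent modulo R to its conjugate.
  UnitModulo : ℤ → Set
  UnitModulo R = ∃ λ x → ∃ λ y → y ≢ + 0 × x * x - d * ((y * R) * (y * R)) ≡ + 1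

  unitModulo : ∀ R → R ≢ + 0 → UnitModulo R
  unitModulo R R≢0 = fromPell (positive R R≢0)
    where
    irrational-dR² : Irrational (d * (R * R))
    irrational-dR² x y x²≡ = [ id , ⊥-elim ∘ R≢0 ]′ (ℤₚ.i*j≡0⇒i≡0∨j≡0 y
      (irrational x (y * R) (trans x²≡ (regroup d y R))))
      where
      regroup : ∀ d y R → d * (R * R) * (y * y) ≡ d * ((y * R) * (y * R))
      regroup = solve-∀
    regroup : ∀ d y R → d * ((y * R) * (y * R)) ≡ d * (R * R) * (y * y)
    regroup = solve-∀
    positive : ∀ R → R ≢ + 0 → ∃ λ D → d * (R * R) ≡ +[1+ D ]
    positive (+ zero)  R≢0 = ⊥-elim (R≢0 refl)
    positive +[1+ _ ]  _   = _ , refl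
    positive -[1+ _ ]  _   = _ , refl
    fromPell : (∃ λ D → d * (R * R) ≡ +[1+ D ]) → UnitModulo R
    fromPell (D , dR²≡D) =
      let x , y , y≢0 , unit = pell {D} (subst Irrational dR²≡D irrational-dR²)
      in x , y , y≢0 , trans (cong (λ z → x * x - z) (trans (regroup d y R) (cong (_* (y * y)) dR²≡D))) unit

  solution : ∀ n k f → 𝟜 ⊗ k ≡ n ⊕ f → n ≢ 𝟘 → k ≢ 𝟘 → f ≢ 𝟘 → ErdosStraus d n
  solution n k f 4k≡n+f n≢0 k≢0 f≢0 = fromUnit (unitModulo (norm f) (f≢0 ∘ norm≡0⇒≡0 f))
    where
    fromUnit : UnitModulo (norm f) → ErdosStraus d n
    fromUnit (x , y , y≢0 , unit) = split {n} {k} {f} {g} {p = withRoot x t} {q = withRoot (- x) t}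
      {p′ = withRoot x (- t) ⊗ (n ⊗ k)} {q′ = withRoot (- x) (- t) ⊗ (n ⊗ k)}
      4k≡n+f p+q≡gf (cofactor x unit) (cofactor (- x) (trans (cong (_- d * (t * t)) (neg-square x)) unit))
      n≢0 k≢0 (⊗-≢𝟘 w≢0 conj-f≢0)
      where
      open ≡-Reasoning
      t : ℤ
      t = y * norm f
      w g : 𝔻
      -- `w` is 2y√d. As p + q = 2t√d with t = yN(f), the sum is w N(f) = (w f̄) f, which gives the
      -- cofactor `g`.
      w = withRoot (+ 0) (+ 2 * y)
      g = w ⊗ conj f
      neg-square : ∀ x → - x * - x ≡ x * x
      neg-square = solve-∀
      cofactor : ∀ x → x * x - d * (t * t) ≡ + 1 →
        withRoot x (- t) ⊗ (n ⊗ k) ⊗ withRoot x t ≡ n ⊗ k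
      cofactor x unit = begin
        withRoot x (- t) ⊗ (n ⊗ k) ⊗ withRoot x t   ≡⟨ *-assoc (withRoot x (- t)) (n ⊗ k) (withRoot x t) ⟩
        withRoot x (- t) ⊗ (n ⊗ k ⊗ withRoot x t)   ≡⟨ cong (withRoot x (- t) ⊗_) (*-comm (n ⊗ k) (withRoot x t)) ⟩
        withRoot x (- t) ⊗ (withRoot x t ⊗ (n ⊗ k)) ≡⟨ *-assoc (withRoot x (- t)) (withRoot x t) (n ⊗ k) ⟨
        withRoot x (- t) ⊗ withRoot x t ⊗ (n ⊗ k)   ≡⟨ cong (_⊗ (n ⊗ k))
                                                          (trans (withRoot-norm x t) (cong (_, + 0) unit)) ⟩
        𝟙 ⊗ (n ⊗ k)                                 ≡⟨ *-identityˡ (n ⊗ k) ⟩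
        n ⊗ k                                       ∎
      p+q≡gf : withRoot x t ⊕ withRoot (- x) t ≡ g ⊗ f
      p+q≡gf = begin
        withRoot x t ⊕ withRoot (- x) t
          ≡⟨ cong₂ _,_ (lemma₁ x y (norm f) (ωc₀ d) (ωc₁ d)) (lemma₂ y (norm f) (ωc₁ d)) ⟩
        w ⊗ (norm f , + 0)   ≡⟨ cong (w ⊗_) (⊗-conj f) ⟨
        w ⊗ (f ⊗ conj f)     ≡⟨ cong (w ⊗_) (*-comm f (conj f)) ⟩
        w ⊗ (conj f ⊗ f)     ≡⟨ *-assoc w (conj f) f ⟨
        g ⊗ f                ∎
        where
        lemma₁ : ∀ x y R c₀ c₁ → (x - y * R * c₁) + (- x - y * R * c₁) ≡
          (+ 0 - + 2 * y * c₁) * R + + 2 * y * (+ 1 + c₁) * + 0 * c₀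
        lemma₁ = solve-∀
        lemma₂ : ∀ y R c₁ → y * R * (+ 1 + c₁) + y * R * (+ 1 + c₁) ≡
          (+ 0 - + 2 * y * c₁) * + 0 + + 2 * y * (+ 1 + c₁) * R + + 2 * y * (+ 1 + c₁) * + 0 * c₁
        lemma₂ = solve-∀
      1+c₁≢0 : + 1 + ωc₁ d ≢ + 0
      1+c₁≢0 eq = [ (λ { (c₁≡1 , _) → case trans (sym (cong (λ c → + 1 + c) c₁≡1)) eq of λ () })
                  , (λ { (c₁≡0 , _) → case trans (sym (cong (λ c → + 1 + c) c₁≡0)) eq of λ () }) ]′ (ω-cases d)
      w≢0 : w ≢ 𝟘
      w≢0 w≡0 = [ [ (λ ()) , y≢0 ]′ ∘ ℤₚ.i*j≡0⇒i≡0∨j≡0 (+ 2) , 1+c₁≢0 ]′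
        (ℤₚ.i*j≡0⇒i≡0∨j≡0 (+ 2 * y) (cong proj₂ w≡0))
      conj-f≢0 : conj f ≢ 𝟘
      conj-f≢0 = factor-≢𝟘 (conj f) f (trans (*-comm (conj f) f) (⊗-conj f)) (f≢0 ∘ norm≡0⇒≡0 f ∘ cong proj₁)

  -- With k = 1 the element f = 4 - n vanishes at n = 4; there k = 2 gives f = 4 instead.
  erdosStraus : ∀ n → n ≢ 𝟘 → ErdosStraus d n
  erdosStraus n n≢0 = [ from2 , from1 ]′ (toSum (n ≟𝔻 𝟜))
    where
    from2 : n ≡ 𝟜 → ErdosStraus d n
    from2 n≡4 = solution n (+ 2 , + 0) 𝟜
      (trans (cong₂ _,_ refl (lemma (ωc₁ d))) (cong (_⊕ 𝟜) (sym n≡4))) n≢0 (λ ()) (λ ())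
      where
      lemma : ∀ c₁ → + 4 * + 0 + + 0 * + 2 + + 0 * + 0 * c₁ ≡ + 0 + + 0
      lemma = solve-∀
    from1 : n ≢ 𝟜 → ErdosStraus d n
    from1 n≢4 = solution n 𝟙 (𝟜 ⊕ (⊖ n))
      (cong₂ _,_ (lemma₁ (proj₁ n) (ωc₀ d)) (lemma₂ (proj₂ n) (ωc₁ d))) n≢0 (λ ())
      (λ 4-n≡0 → n≢4 (sym (cong₂ _,_
        (ℤₚ.i-j≡0⇒i≡j (+ 4) (proj₁ n) (cong proj₁ 4-n≡0))
        (ℤₚ.i-j≡0⇒i≡j (+ 0) (proj₂ n) (cong proj₂ 4-n≡0)))))
      where
      lemma₁ : ∀ a c₀ → + 4 * + 1 + + 0 * + 0 * c₀ ≡ a + (+ 4 + - a)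
      lemma₁ = solve-∀
      lemma₂ : ∀ b c₁ → + 4 * + 0 + + 0 * + 1 + + 0 * + 0 * c₁ ≡ b + (+ 0 + - b)
      lemma₂ = solve-∀

-- Imaginary fields

-- The divisor p of nk in f ∣ p + q, where f = 4k - n.
data Divisor : Set where
  const : 𝔻 → Divisor
  ‵k ‵n ‵nk : Divisor

data Certificate : Set where
  -- c ∣ n, where 4/c = 1/a + 1/b + 1/e
  multiple : (c a b e : 𝔻) → Certificate
  -- n = 4k - f and f ∣ p + q, where q ∣ k
  sum : (f : 𝔻) (p : Divisor) (q : 𝔻) → Certificate

-- Large enough for every certificate below to be well-formed.
exceptionBound : ℕ
exceptionBound = 20

Small : 𝔻 → Set
Small (a , b) = ∣ a ∣ ℕ.≤ exceptionBound × ∣ b ∣ ℕ.≤ exceptionBound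

small? : ∀ x → Dec (Small x)
small? (a , b) = (∣ a ∣ ℕ.≤? exceptionBound) ×-dec (∣ b ∣ ℕ.≤? exceptionBound)

interval : List ℤ
interval = map +_ (upTo (suc exceptionBound)) ++ map (λ i → - (+ i)) (upTo (suc exceptionBound))

∈-interval : ∀ z → ∣ z ∣ ℕ.≤ exceptionBound → z ∈ interval
∈-interval (+ n)    n≤ = ∈-++⁺ˡ (∈-map⁺ +_ (∈-upTo⁺ (s≤s n≤)))
∈-interval -[1+ n ] n≤ = ∈-++⁺ʳ (map +_ (upTo (suc exceptionBound))) (∈-map⁺ (λ i → - (+ i)) (∈-upTo⁺ (s≤s n≤)))

exceptions : List 𝔻
exceptions = cartesianProduct interval interval

∉-exceptions : ∀ n → n ∉ exceptions → ¬ Small n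
∉-exceptions (a , b) n∉ (a≤ , b≤) = n∉ (∈-cartesianProduct⁺ (∈-interval a a≤) (∈-interval b b≤))

T-does : ∀ {A : Set} (a? : Dec A) → T (does a?) → A
T-does (yes a) _ = a

-- Floor division by a natural number, with the junk value 0 for division by 0.
_÷_ : ℤ → ℕ → ℤ
a ÷ zero  = + 0
a ÷ suc n = a /ℕ suc n

-- Completing the square makes 4N positive definite for d < 0. Stated in ℕ, it bounds each
-- coordinate by the norm.
fourNorm : ∀ e a b → let d = -[1+ e ] in
  (ωc₁ d ≡ + 1 × ∣ + 2 * a + b ∣ ℕ.* ∣ + 2 * a + b ∣ ℕ.+ suc e ℕ.* (∣ b ∣ ℕ.* ∣ b ∣)
                 ≡ 4 ℕ.* ∣ Ring.norm d (a , b) ∣) ⊎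
  (ωc₁ d ≡ + 0 × ∣ + 2 * a ∣ ℕ.* ∣ + 2 * a ∣ ℕ.+ suc e ℕ.* 4 ℕ.* (∣ b ∣ ℕ.* ∣ b ∣)
                 ≡ 4 ℕ.* ∣ Ring.norm d (a , b) ∣)
fourNorm e a b = [ inj₁ ∘ case₁ , inj₂ ∘ case₀ ]′ (ω-cases d)
  where
  d N : ℤ
  d = -[1+ e ]
  N = Ring.norm d (a , b)
  absolute : ∀ X K → + 4 * N ≡ X * X + +[1+ K ] * (b * b) →
    ∣ X ∣ ℕ.* ∣ X ∣ ℕ.+ suc K ℕ.* (∣ b ∣ ℕ.* ∣ b ∣) ≡ 4 ℕ.* ∣ N ∣
  absolute X K 4N≡ = begin
    ∣ X ∣ ℕ.* ∣ X ∣ ℕ.+ suc K ℕ.* (∣ b ∣ ℕ.* ∣ b ∣)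
      ≡⟨ cong ∣_∣ (trans (ℤₚ.pos-+ (∣ X ∣ ℕ.* ∣ X ∣) _)
           (cong₂ _+_ (∣i∣²≡i² X) (trans (ℤₚ.pos-* (suc K) _) (cong (+[1+ K ] *_) (∣i∣²≡i² b))))) ⟩
    ∣ X * X + +[1+ K ] * (b * b) ∣ ≡⟨ cong ∣_∣ 4N≡ ⟨
    ∣ + 4 * N ∣ ≡⟨ ℤₚ.abs-* (+ 4) N ⟩
    4 ℕ.* ∣ N ∣ ∎
    where open ≡-Reasoning
  case₁ : ωc₁ d ≡ + 1 × + 4 * ωc₀ d + + 1 ≡ d → _
  case₁ (c₁≡1 , 4c₀+1≡d) = c₁≡1 , absolute (+ 2 * a + b) e
    (trans (cong (λ c → + 4 * (a * a + c * a * b - ωc₀ d * b * b)) c₁≡1)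
      (trans (complete-square a b (ωc₀ d))
        (cong (λ z → (+ 2 * a + b) * (+ 2 * a + b) + - z * (b * b)) 4c₀+1≡d)))
    where
    complete-square : ∀ a b c₀ → + 4 * (a * a + + 1 * a * b - c₀ * b * b) ≡
      (+ 2 * a + b) * (+ 2 * a + b) + - (+ 4 * c₀ + + 1) * (b * b)
    complete-square = solve-∀
  case₀ : ωc₁ d ≡ + 0 × ωc₀ d ≡ d → _
  case₀ (c₁≡0 , c₀≡d) = c₁≡0 , absolute (+ 2 * a) (3 ℕ.+ e ℕ.* 4)
    (trans (cong₂ (λ c c₀ → + 4 * (a * a + c * a * b - c₀ * b * b)) c₁≡0 c₀≡d)
      (trans (rescale a b d) (cong (λ z → + 2 * a * (+ 2 * a) + z * (b * b)) (sym (ℤₚ.pos-* (suc e) 4)))))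
    where
    rescale : ∀ a b d → + 4 * (a * a + + 0 * a * b - d * b * b) ≡ + 2 * a * (+ 2 * a) + - d * + 4 * (b * b)
    rescale = solve-∀

-- Soundness of certificates on residue classes modulo 4P

module Certificates (e : ℕ) (irrational : Irrational -[1+ e ]) (P : ℕ) .{{_ : ℕ.NonZero P}} where
  d : ℤ
  d = -[1+ e ]
  open Ring d
  open Arithmetic d
  open Domain d irrational
  open CommutativeRing 𝔻-commutativeRing
    using (+-assoc; +-comm; *-comm; *-assoc; *-identityˡ; distribˡ; zeroʳ;
           commutativeSemiring; ring; +-abelianGroup)
  open SemiringIdentities commutativeSemiring
  open import Algebra.Properties.AbelianGroup +-abelianGroup using (inverseˡ-unique)
  open import Algebra.Properties.Ring ring using (-‿involutive; -‿distribʳ-*; -‿+-comm)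
  open NegationIdentity 𝔻-commutativeRing using (negated-identity)

  P′ M : 𝔻
  P′ = (+ P , + 0)
  M = 𝟜 ⊗ P′

  scaleDown : ℕ → 𝔻 → 𝔻
  scaleDown m (u , v) = (u ÷ m , v ÷ m)

  -- y x̄ / N(x) with coordinates rounded down, a true quotient only if `Divides` confirms it. Norms
  -- are nonnegative for d < 0, so the absolute value changes nothing.
  _/𝔻_ : 𝔻 → 𝔻 → 𝔻
  y /𝔻 x = scaleDown (∣ norm x ∣) (y ⊗ conj x)

  Divides : 𝔻 → 𝔻 → Set
  Divides x y = (y /𝔻 x) ⊗ x ≡ y

  divides? : ∀ x y → Dec (Divides x y)
  divides? x y = ((y /𝔻 x) ⊗ x) ≟𝔻 y

  value : Divisor → 𝔻 → 𝔻 → 𝔻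
  value (const c) n k = c
  value ‵k        n k = k
  value ‵n        n k = n
  value ‵nk       n k = n ⊗ k

  -- p is compatible with n ↦ n + 4Pt, and p + q can vanish for small n only.
  Admissible : Divisor → 𝔻 → 𝔻 → Set
  Admissible (const c) f q = Divides c P′ × c ⊕ q ≢ 𝟘
  Admissible ‵k        f q = Divides f P′ × Small (𝟜 ⊗ q ⊕ f)
  Admissible ‵n        f q = Divides f P′ × Small q
  Admissible ‵nk       f q = Divides f P′ × (q ≢ 𝟘 × 4 ℕ.* ∣ norm q ∣ ℕ.≤ exceptionBound)

  admissible? : ∀ p f q → Dec (Admissible p f q)
  admissible? (const c) f q = divides? c P′ ×-dec ¬? ((c ⊕ q) ≟𝔻 𝟘)
  admissible? ‵k        f q = divides? f P′ ×-dec small? (𝟜 ⊗ q ⊕ f)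
  admissible? ‵n        f q = divides? f P′ ×-dec small? q
  admissible? ‵nk       f q = divides? f P′ ×-dec (¬? (q ≟𝔻 𝟘) ×-dec 4 ℕ.* ∣ norm q ∣ ℕ.≤? exceptionBound)

  WellFormed : Certificate → Set
  WellFormed (multiple c a b e) = Divides c M ×
    a ≢ 𝟘 × b ≢ 𝟘 × e ≢ 𝟘 × 𝟜 ⊗ a ⊗ b ⊗ e ≡ c ⊗ (b ⊗ e ⊕ a ⊗ e ⊕ a ⊗ b)
  WellFormed (sum f p q) = Divides q P′ × Small f × Admissible p f q

  wellFormed? : ∀ x → Dec (WellFormed x)
  wellFormed? (multiple c a b e) = divides? c M ×-dec
    ¬? (a ≟𝔻 𝟘) ×-dec ¬? (b ≟𝔻 𝟘) ×-dec ¬? (e ≟𝔻 𝟘) ×-dec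
    ((𝟜 ⊗ a ⊗ b ⊗ e) ≟𝔻 (c ⊗ (b ⊗ e ⊕ a ⊗ e ⊕ a ⊗ b)))
  wellFormed? (sum f p q) = divides? q P′ ×-dec small? f ×-dec admissible? p f q

  -- k, n and nk divide nk in any case; a constant has to be tested, and is tested against k.
  ConstDivides : Divisor → 𝔻 → Set
  ConstDivides (const c) k₀ = Divides c k₀
  ConstDivides _         k₀ = ⊤

  constDivides? : ∀ p k₀ → Dec (ConstDivides p k₀)
  constDivides? (const c) k₀ = divides? c k₀
  constDivides? ‵k        k₀ = yes tt
  constDivides? ‵n        k₀ = yes tt
  constDivides? ‵nk       k₀ = yes tt

  -- 4k₀ is written as a sum because this test comes first and rejects most certificates.
  AppliesWith : 𝔻 → 𝔻 → Divisor → 𝔻 → 𝔻 → Set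
  AppliesWith n₀ f p q k₀ =
    k₀ ⊕ k₀ ⊕ k₀ ⊕ k₀ ≡ n₀ ⊕ f × Divides f (value p n₀ k₀ ⊕ q) × Divides q k₀ × ConstDivides p k₀

  appliesWith? : ∀ n₀ f p q k₀ → Dec (AppliesWith n₀ f p q k₀)
  appliesWith? n₀ f p q k₀ = (k₀ ⊕ k₀ ⊕ k₀ ⊕ k₀) ≟𝔻 (n₀ ⊕ f) ×-dec
    divides? f (value p n₀ k₀ ⊕ q) ×-dec divides? q k₀ ×-dec constDivides? p k₀

  Applies : 𝔻 → Certificate → Set
  Applies n₀ (multiple c a b e) = Divides c n₀
  -- (n₀ + f)/4 is rounded down here; the first clause of `AppliesWith` rejects an inexact quotient.
  Applies n₀ (sum f p q)        = AppliesWith n₀ f p q (scaleDown 4 (n₀ ⊕ f))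

  applies? : ∀ n₀ x → Dec (Applies n₀ x)
  applies? n₀ (multiple c a b e) = divides? c n₀
  applies? n₀ (sum f p q)        = appliesWith? n₀ f p q (scaleDown 4 (n₀ ⊕ f))

  ⊖-small : ∀ x → Small x → Small (⊖ x)
  ⊖-small (a , b) (a≤ , b≤) =
    subst (ℕ._≤ exceptionBound) (sym (ℤₚ.∣-i∣≡∣i∣ a)) a≤ , subst (ℕ._≤ exceptionBound) (sym (ℤₚ.∣-i∣≡∣i∣ b)) b≤

  -- With X = 2a + b or X = 2a according to the case, both 2|a| and |b| are at most |X| + |b|.
  -- Natural numbers do not exceed their squares, so this is at most 4N.
  coordinates≤4norm : ∀ a b → ∣ a ∣ ℕ.≤ 4 ℕ.* ∣ norm (a , b) ∣ × ∣ b ∣ ℕ.≤ 4 ℕ.* ∣ norm (a , b) ∣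
  coordinates≤4norm a b =
    [ (λ (_ , eq) → bounds (+ 2 * a + b) e eq 2∣a∣≤₁) , (λ (_ , eq) → bounds (+ 2 * a) (3 ℕ.+ e ℕ.* 4) eq 2∣a∣≤₀) ]′
      (fourNorm e a b)
    where
    open ℕₚ.≤-Reasoning
    cancel : ∀ a b → + 2 * a ≡ + 2 * a + b - b
    cancel = solve-∀
    2∣a∣≤₁ : ∣ + 2 * a ∣ ℕ.≤ ∣ + 2 * a + b ∣ ℕ.+ ∣ b ∣
    2∣a∣≤₁ = subst (λ z → ∣ z ∣ ℕ.≤ ∣ + 2 * a + b ∣ ℕ.+ ∣ b ∣) (sym (cancel a b)) (ℤₚ.∣i-j∣≤∣i∣+∣j∣ (+ 2 * a + b) b)
    2∣a∣≤₀ : ∣ + 2 * a ∣ ℕ.≤ ∣ + 2 * a ∣ ℕ.+ ∣ b ∣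
    2∣a∣≤₀ = ℕₚ.m≤m+n _ _
    bounds : ∀ X K → ∣ X ∣ ℕ.* ∣ X ∣ ℕ.+ suc K ℕ.* (∣ b ∣ ℕ.* ∣ b ∣) ≡ 4 ℕ.* ∣ norm (a , b) ∣ →
      ∣ + 2 * a ∣ ℕ.≤ ∣ X ∣ ℕ.+ ∣ b ∣ →
      ∣ a ∣ ℕ.≤ 4 ℕ.* ∣ norm (a , b) ∣ × ∣ b ∣ ℕ.≤ 4 ℕ.* ∣ norm (a , b) ∣
    bounds X K eq 2∣a∣≤ = a≤ , ℕₚ.≤-trans (ℕₚ.m≤n+m (∣ b ∣) (∣ X ∣)) ∣X∣+∣b∣≤
      where
      ∣X∣+∣b∣≤ : ∣ X ∣ ℕ.+ ∣ b ∣ ℕ.≤ 4 ℕ.* ∣ norm (a , b) ∣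
      ∣X∣+∣b∣≤ = begin
        ∣ X ∣ ℕ.+ ∣ b ∣
          ≤⟨ ℕₚ.+-mono-≤ (n≤n² ∣ X ∣) (ℕₚ.≤-trans (n≤n² ∣ b ∣) (ℕₚ.m≤n*m (∣ b ∣ ℕ.* ∣ b ∣) (suc K))) ⟩
        ∣ X ∣ ℕ.* ∣ X ∣ ℕ.+ suc K ℕ.* (∣ b ∣ ℕ.* ∣ b ∣) ≡⟨ eq ⟩
        4 ℕ.* ∣ norm (a , b) ∣ ∎
      a≤ : ∣ a ∣ ℕ.≤ 4 ℕ.* ∣ norm (a , b) ∣
      a≤ = begin
        ∣ a ∣                     ≤⟨ ℕₚ.m≤n*m (∣ a ∣) 2 ⟩
        2 ℕ.* ∣ a ∣               ≡⟨ ℤₚ.abs-* (+ 2) a ⟨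
        ∣ + 2 * a ∣               ≤⟨ 2∣a∣≤ ⟩
        ∣ X ∣ ℕ.+ ∣ b ∣           ≤⟨ ∣X∣+∣b∣≤ ⟩
        4 ℕ.* ∣ norm (a , b) ∣    ∎

  -- N(n) divides N(q) ≠ 0, which bounds the coordinates of n. This excludes nk + q = 0 for large n.
  cofactor-small : ∀ n k q → n ⊗ k ≡ ⊖ q → q ≢ 𝟘 → 4 ℕ.* ∣ norm q ∣ ℕ.≤ exceptionBound → Small n
  cofactor-small n k q nk≡-q q≢0 bound =
    ℕₚ.≤-trans (proj₁ (coordinates≤4norm (proj₁ n) (proj₂ n))) 4norm≤ ,
    ℕₚ.≤-trans (proj₂ (coordinates≤4norm (proj₁ n) (proj₂ n))) 4norm≤
    where
    open ≡-Reasoning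
    norm-⊖ : ∀ a b c₀ c₁ → - a * - a + c₁ * - a * - b - c₀ * - b * - b ≡ a * a + c₁ * a * b - c₀ * b * b
    norm-⊖ = solve-∀
    norms : ∣ norm n ∣ ℕ.* ∣ norm k ∣ ≡ ∣ norm q ∣
    norms = begin
      ∣ norm n ∣ ℕ.* ∣ norm k ∣ ≡⟨ ℤₚ.abs-* (norm n) (norm k) ⟨
      ∣ norm n * norm k ∣       ≡⟨ cong ∣_∣ (norm-⊗ n k) ⟨
      ∣ norm (n ⊗ k) ∣          ≡⟨ cong (λ z → ∣ norm z ∣) nk≡-q ⟩
      ∣ norm (⊖ q) ∣            ≡⟨ cong ∣_∣ (norm-⊖ (proj₁ q) (proj₂ q) (ωc₀ d) (ωc₁ d)) ⟩
      ∣ norm q ∣                ∎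
    norm-k≢0 : ∣ norm k ∣ ≢ 0
    norm-k≢0 eq = q≢0 (norm≡0⇒≡0 q (ℤₚ.∣i∣≡0⇒i≡0
      (trans (sym norms) (trans (cong (∣ norm n ∣ ℕ.*_) eq) (ℕₚ.*-zeroʳ ∣ norm n ∣)))))
    4norm≤ : 4 ℕ.* ∣ norm n ∣ ℕ.≤ exceptionBound
    4norm≤ = ℕₚ.≤-trans (ℕₚ.*-monoʳ-≤ 4 (subst (∣ norm n ∣ ℕ.≤_) norms
      (ℕₚ.m≤m*n (∣ norm n ∣) (∣ norm k ∣) {{ℕ.≢-nonZero norm-k≢0}}))) bound

  quadruple : ∀ k → 𝟜 ⊗ k ≡ k ⊕ k ⊕ k ⊕ k
  quadruple (a , b) = cong₂ _,_ (lemma₁ a b (ωc₀ d)) (lemma₂ a b (ωc₁ d))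
    where
    lemma₁ : ∀ a b c₀ → + 4 * a + + 0 * b * c₀ ≡ a + a + a + a
    lemma₁ = solve-∀
    lemma₂ : ∀ a b c₁ → + 4 * b + + 0 * a + + 0 * b * c₁ ≡ b + b + b + b
    lemma₂ = solve-∀

  module Sound (n n₀ t : 𝔻) (n≡ : n ≡ M ⊗ t ⊕ n₀) (large : ¬ Small n) where
    n≢0 : n ≢ 𝟘
    n≢0 n≡0 = large (subst Small (sym n≡0) (z≤n , z≤n))

    multiple-sound : ∀ c a b e → Divides c n₀ → WellFormed (multiple c a b e) → ErdosStraus d n
    multiple-sound c a b e c∣n₀ (c∣M , a≢0 , b≢0 , e≢0 , eq) =
      m ⊗ a , m ⊗ b , m ⊗ e , ⊗-≢𝟘 m≢0 a≢0 , ⊗-≢𝟘 m≢0 b≢0 , ⊗-≢𝟘 m≢0 e≢0 ,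
      trans (scaled-identity {four = 𝟜} {a = a} {b = b} {e = e} {z = c} m eq)
        (cong (_⊗ (m ⊗ b ⊗ (m ⊗ e) ⊕ m ⊗ a ⊗ (m ⊗ e) ⊕ m ⊗ a ⊗ (m ⊗ b))) mc≡n)
      where
      m : 𝔻
      m = (M /𝔻 c) ⊗ t ⊕ (n₀ /𝔻 c)
      mc≡n : m ⊗ c ≡ n
      mc≡n = trans (affine-multiple {M} {M /𝔻 c} {n₀} {n₀ /𝔻 c} {c} t c∣M c∣n₀) (sym n≡)
      m≢0 : m ≢ 𝟘
      m≢0 = factor-≢𝟘 m c mc≡n n≢0

    module Sum (f : 𝔻) (p : Divisor) (q k₀ : 𝔻)
               (applies : AppliesWith n₀ f p q k₀) (wellFormed : WellFormed (sum f p q)) where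
      k : 𝔻
      k = P′ ⊗ t ⊕ k₀

      4k≡n+f : 𝟜 ⊗ k ≡ n ⊕ f
      4k≡n+f = trans
        (lift-4 {𝟜} {n₀} {k₀} {f} P′ t (trans (*-comm k₀ 𝟜) (trans (quadruple k₀) (proj₁ applies))))
        (cong (_⊕ f) (sym n≡))

      k/ : 𝔻 → 𝔻
      k/ c = (P′ /𝔻 c) ⊗ t ⊕ (k₀ /𝔻 c)

      affine-divides : ∀ c → Divides c P′ → Divides c k₀ → k/ c ⊗ c ≡ k
      affine-divides c c∣P c∣k₀ = affine-multiple {P′} {P′ /𝔻 c} {k₀} {k₀ /𝔻 c} {c} t c∣P c∣k₀

      cofactor : ∀ c k′ → k′ ⊗ c ≡ k → n ⊗ k′ ⊗ c ≡ n ⊗ k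
      cofactor c k′ k′c≡k = trans (*-assoc n k′ c) (cong (n ⊗_) k′c≡k)

      k≢0 : k ≢ 𝟘
      k≢0 k≡0 = large (subst Small (sym n≡-f) (⊖-small f (proj₁ (proj₂ wellFormed))))
        where
        n≡-f : n ≡ ⊖ f
        n≡-f = inverseˡ-unique n f (trans (sym 4k≡n+f) (trans (cong (𝟜 ⊗_) k≡0) (zeroʳ 𝟜)))

      conclude : ∀ g p′ → value p n k ⊕ q ≡ g ⊗ f → p′ ⊗ value p n k ≡ n ⊗ k →
        value p n k ⊕ q ≢ 𝟘 → ErdosStraus d n
      conclude g p′ p+q≡gf p′p≡nk p+q≢0 =
        split {n} {k} {f} {g} {value p n k} {q} {p′} {n ⊗ k/ q}
          4k≡n+f p+q≡gf p′p≡nk (cofactor q (k/ q) (affine-divides q (proj₁ wellFormed) (proj₁ (proj₂ (proj₂ applies)))))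
          n≢0 k≢0 (factor-≢𝟘 g f (sym p+q≡gf) p+q≢0)

      g₀ : 𝔻
      g₀ = (value p n₀ k₀ ⊕ q) /𝔻 f

      g₀f≡ : g₀ ⊗ f ≡ value p n₀ k₀ ⊕ q
      g₀f≡ = proj₁ (proj₂ applies)

      g : 𝔻 → 𝔻
      g δ = (P′ /𝔻 f) ⊗ δ ⊕ g₀

      -- f keeps dividing p + q when p moves by a multiple of P. The shift δ is t for p = k, 4t for
      -- p = n, and 4tk + n₀t for p = nk.
      shifted : ∀ δ → Divides f P′ → value p n k ≡ P′ ⊗ δ ⊕ value p n₀ k₀ →
        value p n k ⊕ q ≡ g δ ⊗ f
      shifted δ f∣P value≡ = trans (cong (_⊕ q) value≡) (trans (+-assoc (P′ ⊗ δ) (value p n₀ k₀) q)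
        (sym (affine-multiple {P′} {P′ /𝔻 f} {value p n₀ k₀ ⊕ q} {g₀} {f} δ f∣P g₀f≡)))

    sum-sound : ∀ f p q k₀ → AppliesWith n₀ f p q k₀ → WellFormed (sum f p q) → ErdosStraus d n
    sum-sound f (const c) q k₀ ap@(_ , _ , _ , c∣k₀) wf@(_ , _ , c∣P , c+q≢0) =
      -- A constant p makes p + q independent of t, so the cofactor of f found at n₀ serves the
      -- whole class.
      conclude g₀ (n ⊗ k/ c) (sym g₀f≡)
        (cofactor c (k/ c) (affine-divides c c∣P c∣k₀)) c+q≢0
      where open Sum f (const c) q k₀ ap wf
    sum-sound f ‵k q k₀ ap wf@(_ , _ , f∣P , small) =
      conclude (g t) n (shifted t f∣P refl) refl
        λ k+q≡0 → large (subst Small (sym (n≡-4q-f k+q≡0)) (⊖-small (𝟜 ⊗ q ⊕ f) small))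
      where
      open Sum f ‵k q k₀ ap wf
      open ≡-Reasoning
      n≡-4q-f : k ⊕ q ≡ 𝟘 → n ≡ ⊖ (𝟜 ⊗ q ⊕ f)
      n≡-4q-f k+q≡0 = inverseˡ-unique n (𝟜 ⊗ q ⊕ f) (begin
        n ⊕ (𝟜 ⊗ q ⊕ f)  ≡⟨ cong (n ⊕_) (+-comm (𝟜 ⊗ q) f) ⟩
        n ⊕ (f ⊕ 𝟜 ⊗ q)  ≡⟨ +-assoc n f (𝟜 ⊗ q) ⟨
        n ⊕ f ⊕ 𝟜 ⊗ q    ≡⟨ cong (_⊕ 𝟜 ⊗ q) 4k≡n+f ⟨
        𝟜 ⊗ k ⊕ 𝟜 ⊗ q    ≡⟨ distribˡ 𝟜 k q ⟨
        𝟜 ⊗ (k ⊕ q)      ≡⟨ cong (𝟜 ⊗_) k+q≡0 ⟩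
        𝟜 ⊗ 𝟘            ≡⟨ zeroʳ 𝟜 ⟩
        𝟘                ∎)
    sum-sound f ‵n q k₀ ap wf@(_ , _ , f∣P , small) =
      conclude (g (𝟜 ⊗ t)) k
        (shifted (𝟜 ⊗ t) f∣P (trans n≡ (cong (_⊕ n₀) (trans (cong (_⊗ t) (*-comm 𝟜 P′)) (*-assoc P′ 𝟜 t)))))
        (*-comm k n)
        λ n+q≡0 → large (subst Small (sym (inverseˡ-unique n q n+q≡0)) (⊖-small q small))
      where open Sum f ‵n q k₀ ap wf
    sum-sound f ‵nk q k₀ ap wf@(_ , _ , f∣P , q≢0 , bound) =
      conclude (g (𝟜 ⊗ t ⊗ k ⊕ n₀ ⊗ t)) 𝟙
        (shifted (𝟜 ⊗ t ⊗ k ⊕ n₀ ⊗ t) f∣P (trans (cong (_⊗ k) n≡) (product-shift 𝟜 P′ t n₀ k₀)))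
        (*-identityˡ (n ⊗ k))
        λ nk+q≡0 → large (cofactor-small n k q (inverseˡ-unique (n ⊗ k) q nk+q≡0) q≢0 bound)
      where open Sum f ‵nk q k₀ ap wf

    sound : ∀ x → Applies n₀ x → WellFormed x → ErdosStraus d n
    sound (multiple c a b e) = multiple-sound c a b e
    sound (sum f p q)        = sum-sound f p q (scaleDown 4 (n₀ ⊕ f))

  ErdosStraus-⊖ : ∀ n → ErdosStraus d (⊖ n) → ErdosStraus d n
  ErdosStraus-⊖ n (a , b , e , a≢0 , b≢0 , e≢0 , eq) =
    ⊖ a , ⊖ b , ⊖ e , ⊖-≢𝟘 a a≢0 , ⊖-≢𝟘 b b≢0 , ⊖-≢𝟘 e e≢0 ,
    trans (negated-identity {𝟜} {⊖ n} {a} {b} {e} eq)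
      (cong (_⊗ (⊖ b ⊗ ⊖ e ⊕ ⊖ a ⊗ ⊖ e ⊕ ⊖ a ⊗ ⊖ b)) (-‿involutive n))
    where
    ⊖-≢𝟘 : ∀ x → x ≢ 𝟘 → ⊖ x ≢ 𝟘
    ⊖-≢𝟘 x x≢0 -x≡0 = x≢0 (trans (sym (-‿involutive x)) (cong ⊖_ -x≡0))

  period : ℕ
  period = 4 ℕ.* P

  instance
    period≢0 : ℕ.NonZero period
    period≢0 = ℕₚ.m*n≢0 4 P

  -- If a and -a both had residues above 2P, their sum would be a multiple of 4P
  -- strictly between 4P and 8P.
  -residue≤ : ∀ a → 2 ℕ.* P ℕ.< a %ℕ period → (- a) %ℕ period ℕ.≤ 2 ℕ.* P
  -residue≤ a 2P<r = ℕₚ.≮⇒≥ λ 2P<r′ → ℕₚ.<⇒≱ (1<s 2P<r′) (ℕ.s≤s⁻¹ s<2)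
    where
    open ℕₚ.≤-Reasoning
    r r′ s : ℕ
    r  = a %ℕ period
    r′ = (- a) %ℕ period
    q q′ : ℤ
    q  = a /ℕ period
    q′ = (- a) /ℕ period
    s  = ∣ - (q + q′) ∣
    sum≡ : r ℕ.+ r′ ≡ s ℕ.* period
    sum≡ = trans (cong ∣_∣ (ℤ-sum (+ r) (+ r′) q q′ a (+ period)
        (a≡a%ℕn+[a/ℕn]*n a period) (a≡a%ℕn+[a/ℕn]*n (- a) period)))
      (ℤₚ.abs-* (- (q + q′)) (+ period))
      where
      ℤ-sum : ∀ r r′ q q′ a m → a ≡ r + q * m → - a ≡ r′ + q′ * m → r + r′ ≡ - (q + q′) * m
      ℤ-sum r r′ q q′ a m a≡ -a≡ = trans (isolate r r′ q q′ m)
        (trans (cong₂ (λ x y → x + y + - (q + q′) * m) (sym a≡) (sym -a≡)) (cancel a (- (q + q′) * m)))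
        where
        isolate : ∀ r r′ q q′ m → r + r′ ≡ r + q * m + (r′ + q′ * m) + - (q + q′) * m
        isolate = solve-∀
        cancel : ∀ a z → a + - a + z ≡ z
        cancel = solve-∀
    s<2 : s ℕ.< 2
    s<2 = ℕₚ.*-cancelʳ-< period s 2 (begin-strict
      s ℕ.* period        ≡⟨ sum≡ ⟨
      r ℕ.+ r′            <⟨ ℕₚ.+-mono-< (n%ℕd<d a period) (n%ℕd<d (- a) period) ⟩
      period ℕ.+ period   ≡⟨ cong (period ℕ.+_) (ℕₚ.+-identityʳ period) ⟨
      2 ℕ.* period        ∎)
    1<s : 2 ℕ.* P ℕ.< r′ → 1 ℕ.< s
    1<s 2P<r′ = ℕₚ.*-cancelʳ-< period 1 s (begin-strict
      1 ℕ.* period              ≡⟨ ℕₚ.*-identityˡ period ⟩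
      4 ℕ.* P                   ≡⟨ ℕₚ.*-distribʳ-+ P 2 2 ⟩
      2 ℕ.* P ℕ.+ 2 ℕ.* P       <⟨ ℕₚ.+-mono-< 2P<r 2P<r′ ⟩
      r ℕ.+ r′                  ≡⟨ sum≡ ⟩
      s ℕ.* period              ∎)

  residue quotient : 𝔻 → 𝔻
  residue (a , b)  = (+ (a %ℕ period) , + (b %ℕ period))
  quotient (a , b) = (a /ℕ period , b /ℕ period)

  residue-quotient : ∀ n → n ≡ M ⊗ quotient n ⊕ residue n
  residue-quotient (a , b) = cong₂ _,_
    (trans (division a) (lemma₁ (+ P) (a /ℕ period) (b /ℕ period) (+ (a %ℕ period)) (ωc₀ d) (ωc₁ d)))
    (trans (division b) (lemma₂ (+ P) (a /ℕ period) (b /ℕ period) (+ (b %ℕ period)) (ωc₀ d) (ωc₁ d)))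
    where
    division : ∀ a → a ≡ + (a %ℕ period) + (a /ℕ period) * (+ 4 * + P)
    division a = trans (a≡a%ℕn+[a/ℕn]*n a period)
      (cong (λ z → + (a %ℕ period) + (a /ℕ period) * z) (ℤₚ.pos-* 4 P))
    lemma₁ : ∀ P u v r c₀ c₁ → r + u * (+ 4 * P) ≡
      (+ 4 * P + + 0 * + 0 * c₀) * u + (+ 4 * + 0 + + 0 * P + + 0 * + 0 * c₁) * v * c₀ + r
    lemma₁ = solve-∀
    lemma₂ : ∀ P u v r c₀ c₁ → r + v * (+ 4 * P) ≡
      (+ 4 * P + + 0 * + 0 * c₀) * v + (+ 4 * + 0 + + 0 * P + + 0 * + 0 * c₁) * u
        + (+ 4 * + 0 + + 0 * P + + 0 * + 0 * c₁) * v * c₁ + r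
    lemma₂ = solve-∀

  module _ (certificates : List Certificate) where
    covered : 𝔻 → Bool
    covered n₀ =
      any (λ x → does (applies? n₀ x)) certificates ∨ any (λ x → does (applies? (⊖ n₀) x)) certificates

    -- First coordinates up to 2P represent every class up to sign, by `-residue≤`.
    allCovered : Bool
    allCovered = all (λ i → all (λ j → covered (+ i , + j)) (upTo period)) (upTo (suc (2 ℕ.* P)))

    allWellFormed : Bool
    allWellFormed = all (λ x → does (wellFormed? x)) certificates

    module _ (wellFormed : T allWellFormed) where
      sound-any : ∀ n n₀ t → n ≡ M ⊗ t ⊕ n₀ → ¬ Small n →
        T (any (λ x → does (applies? n₀ x)) certificates) → ErdosStraus d n
      sound-any n n₀ t n≡ large applies =
        let x , x∈ , Tx = find (any⁻ (λ x → does (applies? n₀ x)) certificates applies)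
        in Sound.sound n n₀ t n≡ large x (T-does (applies? n₀ x) Tx)
             (T-does (wellFormed? x) (All.lookup (all⁺ (λ x → does (wellFormed? x)) certificates wellFormed) x∈))

      sound-covered : ∀ n → ¬ Small n → T (covered (residue n)) → ErdosStraus d n
      sound-covered n large cov = [ sound-any n (residue n) (quotient n) n≡ large
        , ErdosStraus-⊖ n ∘ sound-any (⊖ n) (⊖ residue n) (⊖ quotient n) -n≡ -large ]′ (Equivalence.to T-∨ cov)
        where
        n≡ : n ≡ M ⊗ quotient n ⊕ residue n
        n≡ = residue-quotient n
        -n≡ : ⊖ n ≡ M ⊗ (⊖ quotient n) ⊕ (⊖ residue n)
        -n≡ = trans (cong ⊖_ n≡) (trans (sym (-‿+-comm (M ⊗ quotient n) (residue n)))
          (cong (_⊕ (⊖ residue n)) (-‿distribʳ-* M (quotient n))))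
        -large : ¬ Small (⊖ n)
        -large = large ∘ subst Small (-‿involutive n) ∘ ⊖-small (⊖ n)

      erdosStraus : T allCovered → ∀ n → ¬ Small n → ErdosStraus d n
      erdosStraus all-covered n large =
        [ half n large , ErdosStraus-⊖ n ∘ half (⊖ n) (large ∘ subst Small (-‿involutive n) ∘ ⊖-small (⊖ n)) ∘ flip ]′
          (ℕₚ.≤-<-connex (proj₁ n %ℕ period) (2 ℕ.* P))
        where
        flip : 2 ℕ.* P ℕ.< proj₁ n %ℕ period → (- proj₁ n) %ℕ period ℕ.≤ 2 ℕ.* P
        flip = -residue≤ (proj₁ n)
        half : ∀ n → ¬ Small n → proj₁ n %ℕ period ℕ.≤ 2 ℕ.* P → ErdosStraus d n
        half n large i≤2P = sound-covered n large
          (All.lookup (all⁺ (λ j → covered (+ (proj₁ n %ℕ period) , + j)) (upTo period)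
            (All.lookup (all⁺ (λ i → all (λ j → covered (+ i , + j)) (upTo period)) (upTo (suc (2 ℕ.* P))) all-covered)
              (∈-upTo⁺ (s≤s i≤2P))))
            (∈-upTo⁺ (n%ℕd<d (proj₂ n) period)))

-- A bound on d for norm-Euclidean imaginary fields

1-2z≢0 : ∀ z → + 1 - + 2 * z ≢ + 0
1-2z≢0 z eq = ℕₚ.even≢odd (∣ z ∣) 0
  (trans (sym (ℤₚ.abs-* (+ 2) z)) (cong ∣_∣ (sym (ℤₚ.i-j≡0⇒i≡j (+ 1) (+ 2 * z) eq))))

0<∣odd∣² : ∀ z → 1 ℕ.≤ ∣ + 1 - + 2 * z ∣ ℕ.* ∣ + 1 - + 2 * z ∣
0<∣odd∣² z = ℕₚ.*-mono-≤ {1} {_} {1} pos pos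
  where
  pos : 1 ℕ.≤ ∣ + 1 - + 2 * z ∣
  pos = ℕₚ.n≢0⇒n>0 (1-2z≢0 z ∘ ℤₚ.∣i∣≡0⇒i≡0)

module _ (e : ℕ) where
  private
    d : ℤ
    d = -[1+ e ]

  open Ring d

  -- The class of ω modulo 2 has no element of norm below 4 unless |d| is small.
  normEuclidean-bound : NormEuclidean d → (ωc₁ d ≡ + 1 × e ℕ.≤ 10) ⊎ (ωc₁ d ≡ + 0 × e ℕ.≤ 2)
  normEuclidean-bound euclid = bound (euclid (+ 0 , + 1) (+ 2 , + 0) λ ())
    where
    bound : (∃ λ q → ∃ λ r → (+ 0 , + 1) ≡ q ⊗ (+ 2 , + 0) ⊕ r × ∣ norm r ∣ ℕ.< ∣ norm (+ 2 , + 0) ∣) → _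
    bound ((s , t) , (u , v) , x≡ , small) = [ inj₁ ∘ case₁ , inj₂ ∘ case₀ ]′ (fourNorm e u v)
      where
      open ℕₚ.≤-Reasoning
      norm-2 : ∀ c₀ c₁ → + 2 * + 2 + c₁ * + 2 * + 0 - c₀ * + 0 * + 0 ≡ + 4
      norm-2 = solve-∀
      norm≤3 : ∣ norm (u , v) ∣ ℕ.≤ 3
      norm≤3 = ℕ.s≤s⁻¹ (subst (∣ norm (u , v) ∣ ℕ.<_) (cong ∣_∣ (norm-2 (ωc₀ d) (ωc₁ d))) small)
      4norm≤12 : 4 ℕ.* ∣ norm (u , v) ∣ ℕ.≤ 12
      4norm≤12 = ℕₚ.*-monoʳ-≤ 4 norm≤3
      v≡ : v ≡ + 1 - + 2 * t
      v≡ = trans (isolate s t v (ωc₁ d)) (cong (_- + 2 * t) (sym (cong proj₂ x≡)))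
        where
        isolate : ∀ s t v c₁ → v ≡ s * + 0 + t * + 2 + t * + 0 * c₁ + v - + 2 * t
        isolate = solve-∀
      2u+v≡ : + 2 * u + v ≡ + 1 - + 2 * (t + + 2 * s)
      2u+v≡ = trans (isolate s t u v (ωc₀ d))
        (trans (cong₂ (λ x y → + 2 * x - + 4 * s + y) (sym (cong proj₁ x≡)) v≡) (collect s t))
        where
        isolate : ∀ s t u v c₀ → + 2 * u + v ≡ + 2 * (s * + 2 + t * + 0 * c₀ + u) - + 4 * s + v
        isolate = solve-∀
        collect : ∀ s t → + 2 * + 0 - + 4 * s + (+ 1 - + 2 * t) ≡ + 1 - + 2 * (t + + 2 * s)
        collect = solve-∀
      0<∣v∣² : 1 ℕ.≤ ∣ v ∣ ℕ.* ∣ v ∣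
      0<∣v∣² = subst (λ z → 1 ℕ.≤ ∣ z ∣ ℕ.* ∣ z ∣) (sym v≡) (0<∣odd∣² t)
      0<∣2u+v∣² : 1 ℕ.≤ ∣ + 2 * u + v ∣ ℕ.* ∣ + 2 * u + v ∣
      0<∣2u+v∣² = subst (λ z → 1 ℕ.≤ ∣ z ∣ ℕ.* ∣ z ∣) (sym 2u+v≡) (0<∣odd∣² (t + + 2 * s))
      -- The remainder u + vω is congruent to ω modulo 2, so v and 2u + v are odd. Here 1 + |d| ≤ 4N
      -- ≤ 12; in the other case 4|d| ≤ 4N ≤ 12.
      case₁ : _ → ωc₁ d ≡ + 1 × e ℕ.≤ 10
      case₁ (c₁≡1 , eq) = c₁≡1 , ℕ.s≤s⁻¹ (ℕ.s≤s⁻¹ (begin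
        1 ℕ.+ suc e ≡⟨ cong suc (ℕₚ.*-identityʳ (suc e)) ⟨
        1 ℕ.+ suc e ℕ.* 1 ≤⟨ ℕₚ.+-mono-≤ 0<∣2u+v∣² (ℕₚ.*-monoʳ-≤ (suc e) 0<∣v∣²) ⟩
        ∣ + 2 * u + v ∣ ℕ.* ∣ + 2 * u + v ∣ ℕ.+ suc e ℕ.* (∣ v ∣ ℕ.* ∣ v ∣) ≡⟨ eq ⟩
        4 ℕ.* ∣ norm (u , v) ∣ ≤⟨ 4norm≤12 ⟩
        12 ∎))
      case₀ : _ → ωc₁ d ≡ + 0 × e ℕ.≤ 2
      case₀ (c₁≡0 , eq) = c₁≡0 , ℕ.s≤s⁻¹ (ℕₚ.*-cancelʳ-≤ (suc e) 3 4 (begin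
        suc e ℕ.* 4 ≡⟨ ℕₚ.*-identityʳ (suc e ℕ.* 4) ⟨
        suc e ℕ.* 4 ℕ.* 1 ≤⟨ ℕₚ.*-monoʳ-≤ (suc e ℕ.* 4) 0<∣v∣² ⟩
        suc e ℕ.* 4 ℕ.* (∣ v ∣ ℕ.* ∣ v ∣) ≤⟨ ℕₚ.m≤n+m _ (∣ + 2 * u ∣ ℕ.* ∣ + 2 * u ∣) ⟩
        ∣ + 2 * u ∣ ℕ.* ∣ + 2 * u ∣ ℕ.+ suc e ℕ.* 4 ℕ.* (∣ v ∣ ℕ.* ∣ v ∣) ≡⟨ eq ⟩
        4 ℕ.* ∣ norm (u , v) ∣ ≤⟨ 4norm≤12 ⟩
        12 ∎))

-- Covering certificates for the five imaginary fields

-- Found by a computer search over f and q of small norm.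
certificates₋₁ : List Certificate
certificates₋₁ =
    multiple (+ 2 , + 0) (+ 1 , + 0) (+ 1 , - + 1) (+ 1 , + 1)
  ∷ multiple (+ 2 , - + 1) (+ 1 , + 0) (+ 1 , - + 1) (+ 1 , - + 3)
  ∷ multiple (+ 2 , + 1) (+ 1 , + 0) (+ 1 , + 1) (+ 1 , + 3)
  ∷ sum (+ 1 , + 0) (const (+ 1 , + 0)) (+ 1 , + 0)
  ∷ sum (+ 0 , + 1) (const (+ 1 , + 0)) (+ 1 , + 0)
  ∷ sum (+ 1 , - + 1) (const (+ 1 , + 0)) (+ 1 , + 0)
  ∷ sum (+ 1 , + 1) (const (+ 1 , + 0)) (+ 1 , + 0)
  -- Modulo f of norm 5 one has n ≡ 4k ≡ -k, so nk ≡ -n² ≡ ±1 unless f divides n. In that case n is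
  -- a multiple of 2 - i or 2 + i, treated above.
  ∷ sum (+ 2 , - + 1) ‵nk (+ 1 , + 0)
  ∷ sum (+ 2 , - + 1) ‵nk (- + 1 , + 0)
  ∷ sum (+ 1 , - + 2) ‵nk (+ 1 , + 0)
  ∷ sum (+ 1 , - + 2) ‵nk (- + 1 , + 0)
  ∷ []

certificates₋₂ : List Certificate
certificates₋₂ =
    multiple (+ 2 , + 0) (+ 1 , + 0) (+ 2 , + 0) (+ 2 , + 0)
  ∷ sum (+ 1 , + 0) (const (+ 1 , + 0)) (+ 1 , + 0)
  ∷ sum (+ 0 , + 1) (const (+ 1 , + 0)) (+ 1 , + 0)
  ∷ sum (+ 1 , - + 1) ‵nk (- + 1 , + 0)
  ∷ sum (+ 1 , + 1) ‵nk (- + 1 , + 0)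
  ∷ sum (+ 2 , - + 1) (const (+ 1 , - + 1)) (+ 1 , + 0)
  ∷ multiple (+ 2 , + 1) (+ 1 , + 0) (+ 0 , + 1) (+ 2 , + 1)
  ∷ sum (+ 1 , - + 1) (const (+ 1 , - + 1)) (+ 1 , - + 1)
  ∷ sum (+ 1 , + 1) (const (+ 1 , + 1)) (+ 1 , + 1)
  ∷ sum (+ 1 , - + 2) ‵nk (- + 1 , + 0)
  ∷ sum (+ 2 , + 1) ‵k (+ 1 , + 0)
  ∷ sum (+ 2 , + 1) ‵k (+ 0 , + 1)
  ∷ sum (+ 1 , - + 2) ‵k (+ 1 , + 0)
  ∷ sum (+ 1 , - + 2) ‵n (+ 1 , + 0)
  ∷ sum (+ 1 , - + 2) ‵k (- + 1 , + 0)
  ∷ sum (+ 1 , - + 2) ‵n (- + 1 , + 0)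
  ∷ multiple (+ 1 , - + 2) (+ 0 , - + 1) (+ 1 , - + 1) (+ 6 , - + 3)
  ∷ sum (+ 1 , - + 2) ‵k (+ 1 , + 1)
  ∷ sum (+ 1 , - + 2) ‵k (- + 1 , - + 1)
  ∷ []

certificates₋₃ : List Certificate
certificates₋₃ =
    multiple (+ 2 , + 0) (+ 1 , + 0) (+ 0 , + 1) (+ 1 , - + 1)
  ∷ sum (+ 1 , + 0) (const (+ 1 , + 0)) (+ 1 , + 0)
  ∷ sum (+ 0 , + 1) (const (+ 1 , + 0)) (+ 1 , + 0)
  ∷ sum (+ 1 , - + 1) (const (+ 1 , + 0)) (+ 1 , + 0)
  -- From here on f has norm 3 and is an associate of 1 + ω, which is a sum of two units.
  ∷ sum (+ 1 , + 1) (const (+ 0 , + 1)) (+ 1 , + 0)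
  ∷ sum (+ 2 , - + 1) (const (+ 0 , + 1)) (+ 1 , + 0)
  ∷ sum (+ 1 , - + 2) (const (+ 0 , + 1)) (+ 1 , + 0)
  ∷ []

certificates₋₇ : List Certificate
certificates₋₇ =
    multiple (+ 2 , + 0) (+ 1 , + 0) (+ 2 , + 0) (+ 2 , + 0)
  ∷ multiple (+ 1 , + 1) (+ 1 , + 0) (+ 0 , + 1) (+ 0 , + 1)
  ∷ multiple (+ 2 , - + 1) (+ 1 , + 0) (+ 1 , - + 1) (+ 1 , - + 1)
  ∷ sum (+ 1 , + 0) (const (+ 1 , + 0)) (+ 1 , + 0)
  ∷ sum (+ 0 , + 1) (const (+ 1 , + 0)) (+ 1 , + 0)
  ∷ sum (+ 1 , - + 1) (const (+ 1 , + 0)) (+ 1 , + 0)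
  -- Modulo f = 1 - 2ω of norm 7, with n ≡ 4k: nk - 1 handles n ≡ ±2, k ± 1 handles n ≡ ±4, n ± 1
  -- handles n ≡ ±1, and the multiple of f handles n ≡ 0.
  ∷ sum (+ 1 , - + 2) ‵nk (- + 1 , + 0)
  ∷ multiple (+ 1 , - + 2) (+ 1 , - + 1) (+ 0 , - + 1) (+ 2 , - + 4)
  ∷ sum (+ 1 , - + 2) ‵k (+ 1 , + 0)
  ∷ sum (+ 1 , - + 2) ‵n (+ 1 , + 0)
  ∷ sum (+ 1 , - + 2) ‵k (- + 1 , + 0)
  ∷ sum (+ 1 , - + 2) ‵n (- + 1 , + 0)
  ∷ []

certificates₋₁₁ : List Certificate
certificates₋₁₁ =
    multiple (+ 2 , + 0) (+ 1 , + 0) (+ 2 , + 0) (+ 2 , + 0)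
  ∷ sum (+ 1 , + 0) (const (+ 1 , + 0)) (+ 1 , + 0)
  ∷ sum (+ 0 , + 1) ‵nk (- + 1 , + 0)
  ∷ sum (+ 1 , - + 1) ‵nk (- + 1 , + 0)
  ∷ sum (+ 1 , + 1) ‵nk (+ 1 , + 0)
  ∷ sum (+ 1 , + 1) ‵nk (- + 1 , + 0)
  ∷ sum (+ 2 , - + 1) ‵nk (+ 1 , + 0)
  ∷ sum (+ 2 , - + 1) ‵nk (- + 1 , + 0)
  ∷ sum (+ 1 , + 2) ‵nk (- + 1 , + 0)
  -- With p = q = f only f ∣ k is required. For f of norm 3 or 5 this complements q = ±1 above: 4 ≡
  -- ±1 modulo f, so nk ≡ ±k² ≡ ±1 unless f ∣ k.
  ∷ sum (+ 0 , + 1) (const (+ 0 , + 1)) (+ 0 , + 1)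
  ∷ sum (+ 1 , - + 1) (const (+ 1 , - + 1)) (+ 1 , - + 1)
  ∷ sum (+ 1 , + 1) (const (+ 1 , + 1)) (+ 1 , + 1)
  ∷ sum (+ 2 , - + 1) (const (+ 2 , - + 1)) (+ 2 , - + 1)
  -- This q has norm 5, the largest used with `‵nk`; the value 20 of `exceptionBound` is 4 · 5.
  ∷ sum (+ 1 , + 2) ‵nk (- + 2 , + 1)
  ∷ sum (+ 1 , + 2) ‵k (+ 1 , + 0)
  ∷ sum (+ 1 , + 2) ‵n (+ 1 , + 0)
  ∷ sum (+ 1 , + 2) ‵k (- + 1 , + 0)
  ∷ sum (+ 1 , + 2) ‵n (- + 1 , + 0)
  ∷ sum (+ 1 , + 2) ‵nk (+ 1 , - + 1)
  ∷ sum (+ 1 , + 2) ‵nk (- + 1 , + 1)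
  ∷ multiple (+ 1 , + 2) (+ 1 , + 0) (- + 1 , + 1) (- + 2 , + 1)
  ∷ []

-- In each field P is the least number divisible by all q, all constant p, and all f used with a
-- nonconstant p: 5 and 7 are norms of such f, 18 is the least common multiple of N(1 - 2ω) = 9 and
-- N(2 + ω) = 6, and 15 is N(1 + 2ω). For d = -3 all p and q are units, so P = 1.
erdosStraus₋₁ : Irrational -[1+ 0 ] → ∀ n → ¬ Small n → ErdosStraus -[1+ 0 ] n
erdosStraus₋₁ irr = Certificates.erdosStraus 0 irr 5 certificates₋₁ tt tt

erdosStraus₋₂ : Irrational -[1+ 1 ] → ∀ n → ¬ Small n → ErdosStraus -[1+ 1 ] n
erdosStraus₋₂ irr = Certificates.erdosStraus 1 irr 18 certificates₋₂ tt tt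

erdosStraus₋₃ : Irrational -[1+ 2 ] → ∀ n → ¬ Small n → ErdosStraus -[1+ 2 ] n
erdosStraus₋₃ irr = Certificates.erdosStraus 2 irr 1 certificates₋₃ tt tt

erdosStraus₋₇ : Irrational -[1+ 6 ] → ∀ n → ¬ Small n → ErdosStraus -[1+ 6 ] n
erdosStraus₋₇ irr = Certificates.erdosStraus 6 irr 7 certificates₋₇ tt tt

erdosStraus₋₁₁ : Irrational -[1+ 10 ] → ∀ n → ¬ Small n → ErdosStraus -[1+ 10 ] n
erdosStraus₋₁₁ irr = Certificates.erdosStraus 10 irr 15 certificates₋₁₁ tt tt

imaginary : ∀ e → Irrational -[1+ e ] → (ωc₁ -[1+ e ] ≡ + 1 × e ℕ.≤ 10) ⊎ (ωc₁ -[1+ e ] ≡ + 0 × e ℕ.≤ 2) →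
  (n : 𝔻) → n ∉ exceptions → ErdosStraus -[1+ e ] n
imaginary 0 irr _ n n∉ = erdosStraus₋₁ irr n (∉-exceptions n n∉)
imaginary 1 irr _ n n∉ = erdosStraus₋₂ irr n (∉-exceptions n n∉)
imaginary 2 irr _ n n∉ = erdosStraus₋₃ irr n (∉-exceptions n n∉)
imaginary 6 irr _ n n∉ = erdosStraus₋₇ irr n (∉-exceptions n n∉)
imaginary 10 irr _ n n∉ = erdosStraus₋₁₁ irr n (∉-exceptions n n∉)
-- For d = -4, -5, -6, -8, -9, -10 one has d ≢ 1 modulo 4, so `ωc₁` is 0; the stricter bound for
-- that case then excludes them.
imaginary 3  _ (inj₁ (() , _))
imaginary 4  _ (inj₁ (() , _))
imaginary 5  _ (inj₁ (() , _))
imaginary 7  _ (inj₁ (() , _))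
imaginary 8  _ (inj₁ (() , _))
imaginary 9  _ (inj₁ (() , _))
imaginary (suc (suc (suc _))) _ (inj₂ (_ , s≤s (s≤s ())))
imaginary (suc (suc (suc (suc (suc (suc (suc (suc (suc (suc (suc _))))))))))) _
  (inj₁ (_ , s≤s (s≤s (s≤s (s≤s (s≤s (s≤s (s≤s (s≤s (s≤s (s≤s ())))))))))))

theorem2 : (d : ℤ) → Squarefree d → d ≢ + 1 → NormEuclidean d →
    Σ (List 𝔻) λ E → ((n : 𝔻) → n ∉ E → ErdosStraus d n)
theorem2 (+ zero) squarefree _ _ = case squarefree 2 (divides 0 refl) of λ ()
theorem2 +[1+ m ] squarefree d≢1 _ = Ring.𝟘 +[1+ m ] ∷ [] ,
  λ n n∉ → RealCase.erdosStraus m (squarefree⇒irrational +[1+ m ] squarefree d≢1) n (n∉ ∘ here)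
theorem2 -[1+ e ] squarefree d≢1 euclid = exceptions ,
  imaginary e (squarefree⇒irrational -[1+ e ] squarefree d≢1) (normEuclidean-bound e euclid)
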